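{- For every positive integer $n$: (a) $\mathcal{J}^*_6(2n)$ and $\mathcal{J}_6(2n)$ are even; (b) $\mathcal{J}_6(4n+1)$ is even; (c) $\mathcal{J}^*_6(24n+11)$, $\mathcal{J}^*_6(24n+19)$, $\mathcal{J}_6(24n+11)$ and $\mathcal{J}_6(24n+19)$ are even; (d) $\mathcal{J}^*_6(4n-1)$ and $\mathcal{J}_6(4n-1)$ have the same parity; (e) $\mathcal{J}^*_6(8n+1)$ and $\mathcal{J}_6(24n+3)$ have the same parity.
   Context: Let $q=e^{2\pi i\tau}$ with $\tau$ in the upper half-plane, and let $\eta(\tau)=q^{1/24}\prod_{n\ge1}(1-q^n)$ be the Dedekind eta function. Define the Hauptmoduln \[ j_6(\tau)=\left(\frac{\eta(2\tau)\eta(3\tau)^3}{\eta(\tau)\eta(6\tau)^3}\right)^3-3=\frac1q+\sum_{n\ge1}\mathcal{J}_6(n)q^n, \] \[ j_6^*(\tau)=\left(\frac{\eta(\tau)\eta(3\tau)}{\eta(2\tau)\eta(6\tau)}\right)^6+6+2^6\left(\frac{\eta(2\tau)\eta(6\tau)}{\eta(\tau)\eta(3\tau)}\right)^6=\frac1q+\sum_{n\ge1}\mathcal{J}^*_6(n)q^n, \] so $\mathcal{J}_6(n)$ and $\mathcal{J}^*_6(n)$ denote their $n$-th Fourier coefficients (integers). -}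

module Defs where

open import Data.Nat as ℕ using (ℕ; zero; suc; _∸_)
open import Data.Nat.Divisibility using (_∣?_)
open import Data.Integer using (ℤ; +_; -_; _+_; _*_; _-_; 0ℤ; 1ℤ)
open import Data.Bool using (if_then_else_)
open import Relation.Nullary using (does)

-- Formal power series in q with integer coefficients: n ↦ coefficient of q^n.
Series : Set
Series = ℕ → ℤ

mul : Series → Series → Series
mul f g n = go n
  where
  go : ℕ → ℤ
  go zero    = f 0 * g n
  go (suc i) = f (suc i) * g (n ∸ suc i) + go i

one : Series
one zero    = 1ℤ
one (suc _) = 0ℤ

pow : Series → ℕ → Series
pow f zero    = one
pow f (suc e) = mul (pow f e) f

-- The series 1 - q^m (used with m ≥ 1).
fac : ℕ → Series
fac m zero = 1ℤ
fac m (suc n) = if does (m ℕ.≟ suc n) then - 1ℤ else 0ℤ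

-- The series 1/(1 - q^m) = Σ_{k≥0} q^{mk}  (used with m ≥ 1).
invFac : ℕ → Series
invFac m n = if does (m ∣? n) then 1ℤ else 0ℤ

prodUpTo : (ℕ → Series) → ℕ → Series
prodUpTo F zero    = one
prodUpTo F (suc N) = mul (prodUpTo F N) (F (suc N))

-- Infinite product ∏_{k≥1} F(k), valid when F(k) ≡ 1 mod q^k:
-- the coefficient of q^n only depends on the factors k ≤ n.
prodInf : (ℕ → Series) → Series
prodInf F n = prodUpTo F n n

-- P_d(q) = ∏_{k≥1} (1 - q^{dk}), so η(dτ) = q^{d/24} P_d(q).
P : ℕ → Series
P d = prodInf (λ k → fac (d ℕ.* k))

Pinv : ℕ → Series
Pinv d = prodInf (λ k → invFac (d ℕ.* k))

-- η(2τ)η(3τ)^3/(η(τ)η(6τ)^3) = q^{-1/3} · B(q)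
B : Series
B = mul (mul (P 2) (pow (P 3) 3)) (mul (Pinv 1) (pow (Pinv 6) 3))

-- η(τ)η(3τ)/(η(2τ)η(6τ)) = q^{-1/6} · A(q),  and its inverse q^{1/6} · Ainv(q)
A : Series
A = mul (mul (P 1) (P 3)) (mul (Pinv 2) (Pinv 6))

Ainv : Series
Ainv = mul (mul (P 2) (P 6)) (mul (Pinv 1) (Pinv 3))

B³ A⁶ Ainv⁶ : Series
B³ = pow B 3
A⁶ = pow A 6
Ainv⁶ = pow Ainv 6

-- j_6 = q^{-1} B(q)^3 - 3 ;  J6 n = coefficient of q^n (n ≥ 0).
J6 : ℕ → ℤ
J6 zero    = B³ 1 - + 3
J6 (suc n) = B³ (suc (suc n))

-- j_6^* = q^{-1} A^6 + 6 + 64 q Ainv^6 ;  J6* n = coefficient of q^n (n ≥ 0).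
J6* : ℕ → ℤ
J6* zero    = A⁶ 1 + + 6
J6* (suc n) = A⁶ (suc (suc n)) + + 64 * Ainv⁶ n

{-# OPTIONS --safe #-}

-- Work over F₂, with E d = ∏ (1 - q^{dk}). Shanks's finite forms of the pentagonal and
-- triangular number theorems give E 1 = Σ q^{n(3n+1)/2} and E 1³ = Σ q^{n(n+1)/2}, and splitting
-- the latter sum by n mod 3 gives E 1³ = E 3 + q E 9³. From this, the series
-- D(q) = E 1³ E 3³ + E 1¹² + q E 3¹² satisfies D(q) = q D(q³), so D = 0. With u = (E 1 / E 3)³
-- and v = 1 / u it follows that q j₆ = u⁴ and q j₆* = u⁴ + q² v⁴, while
-- u(q) = E 3⁻² + q v(q³). Since squaring is q ↦ q² over F₂, all five parts are read off
-- from these three formulas.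

module Submission where

open import Defs
open import Algebra.Bundles using (AbelianGroup; CommutativeRing)
import Algebra.Construct.Pointwise as Pointwise
open import Algebra.Solver.Ring.AlmostCommutativeRing
  using (fromCommutativeRing; _-Raw-AlmostCommutative⟶_; Induced-equivalence)
open import Data.Bool.Base using (Bool; true; false; if_then_else_; _xor_; _∧_; not)
open import Data.Bool.Properties
  using (xor-∧-commutativeRing; xor-identityʳ; xor-same; xor-comm; xor-assoc; true-xor; not-involutive;
         ∧-comm; ∧-zeroʳ; ∧-idem; ∧-distribʳ-xor)
  renaming (_≟_ to _≟ᵇ_)
open import Data.Integer.Base as ℤ using (ℤ; +_; -[1+_]; _⊖_)
import Data.Integer.Properties as ℤ
open import Data.Integer.Divisibility using (_∣_)
open import Data.Maybe.Base using (map)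
open import Data.Nat.Base as ℕ using (ℕ; zero; suc; _∸_; _<_; _≤_; z≤n; s≤s; _≡ᵇ_; NonZero)
import Data.Nat.Divisibility as ℕ
import Data.Nat.Properties as ℕ
open import Data.Nat.Tactic.RingSolver using (solve-∀)
open import Data.Product using (_×_; _,_; proj₁; proj₂; ∃-syntax)
open import Function using (_∘_)
open import Function.Bundles using (mk⇔)
open import Relation.Binary.Bundles using (Setoid)
open import Relation.Binary.Definitions using (WeaklyDecidable)
open import Relation.Binary.PropositionalEquality as ≡ using (_≡_; _≗_)
open import Relation.Nullary using (does; yes; no)
open import Relation.Nullary.Decidable using (dec⇒maybe; dec-true; dec-false; does-⇔)

-- Modulo 2, E (2d) is the square of E d, so the level 6 quotients involve only E 1 and E 3: `B³`
-- becomes E 1³ E 3³ / E 3¹² and `A⁶` becomes (E 1³ E 3³)² / (E 1 E 3)¹². The vanishing of D is what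
-- trades the mixed product for twelfth powers, hence for fourth powers of u and v. No limits are
-- taken: Shanks's forms are polynomial identities in an arbitrary element x of a ring of
-- characteristic 2, with an error that is a multiple of x ^ n. They become congruences modulo q ^ n
-- once x is q ^ d. The modulus 24 is 4 · 6. The 4 comes from the fourth powers. The 6 comes from u:
-- its part E 3⁻² is a square and has even exponents only, while q v(q³) has exponents 1 mod 3. So
-- the odd exponents occurring in u are 1 mod 6, and the empty classes k = 3 and 5 mod 6 become 24n
-- + 11 and 24n + 19 under k ↦ 4k - 1.

-- Triangular numbers by residue of the index modulo 3 and 2

triangular : ℕ → ℕ
triangular zero    = 0
triangular (suc n) = triangular n ℕ.+ suc n

triangular-1+3m : ∀ m → triangular (1 ℕ.+ m ℕ.* 3) ≡ 1 ℕ.+ 9 ℕ.* triangular m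
triangular-1+3m zero = ≡.refl
triangular-1+3m (suc m) rewrite triangular-1+3m m = lemma (triangular m) m
  where
  lemma : ∀ t m → 1 ℕ.+ 9 ℕ.* t ℕ.+ (2 ℕ.+ m ℕ.* 3) ℕ.+ (3 ℕ.+ m ℕ.* 3) ℕ.+ (4 ℕ.+ m ℕ.* 3)
                  ≡ 1 ℕ.+ 9 ℕ.* (t ℕ.+ suc m)
  lemma = solve-∀

-- Three times the generalized pentagonal number k² + k(k-1)/2 with k = m + 1, split as in the terms
-- of `pentagonalSum`; `triangular-3+3m` gives its partner k² + k(k+1)/2.
triangular-2+3m : ∀ m → triangular (2 ℕ.+ m ℕ.* 3) ≡ 3 ℕ.* (suc m ℕ.* suc m) ℕ.+ 3 ℕ.* triangular m
triangular-2+3m zero = ≡.refl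
triangular-2+3m (suc m) rewrite triangular-2+3m m = lemma (triangular m) m
  where
  lemma : ∀ t m → 3 ℕ.* (suc m ℕ.* suc m) ℕ.+ 3 ℕ.* t
                    ℕ.+ (3 ℕ.+ m ℕ.* 3) ℕ.+ (4 ℕ.+ m ℕ.* 3) ℕ.+ (5 ℕ.+ m ℕ.* 3)
                  ≡ 3 ℕ.* (suc (suc m) ℕ.* suc (suc m)) ℕ.+ 3 ℕ.* (t ℕ.+ suc m)
  lemma = solve-∀

triangular-3+3m : ∀ m → triangular (3 ℕ.+ m ℕ.* 3)
                        ≡ 3 ℕ.* (suc m ℕ.* suc m) ℕ.+ 3 ℕ.* triangular (suc m)
triangular-3+3m m rewrite triangular-2+3m m = lemma (triangular m) m
  where
  lemma : ∀ t m → 3 ℕ.* (suc m ℕ.* suc m) ℕ.+ 3 ℕ.* t ℕ.+ (3 ℕ.+ m ℕ.* 3)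
                  ≡ 3 ℕ.* (suc m ℕ.* suc m) ℕ.+ 3 ℕ.* (t ℕ.+ suc m)
  lemma = solve-∀

triangular-1+2m : ∀ m → triangular (1 ℕ.+ m ℕ.* 2) ≡ (1 ℕ.+ m ℕ.* 2) ℕ.* suc m
triangular-1+2m zero = ≡.refl
triangular-1+2m (suc m) rewrite triangular-1+2m m = lemma m
  where
  lemma : ∀ m → suc (m ℕ.* 2) ℕ.* suc m ℕ.+ (2 ℕ.+ m ℕ.* 2) ℕ.+ (3 ℕ.+ m ℕ.* 2)
                ≡ (3 ℕ.+ m ℕ.* 2) ℕ.* suc (suc m)
  lemma = solve-∀

triangular-2+2m : ∀ m → triangular (2 ℕ.+ m ℕ.* 2) ≡ (3 ℕ.+ m ℕ.* 2) ℕ.* suc m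
triangular-2+2m m rewrite triangular-1+2m m = lemma m
  where
  lemma : ∀ m → suc (m ℕ.* 2) ℕ.* suc m ℕ.+ (2 ℕ.+ m ℕ.* 2) ≡ (3 ℕ.+ m ℕ.* 2) ℕ.* suc m
  lemma = solve-∀

-- Identities in commutative rings of characteristic 2

module Char2 {r ℓ} (R : CommutativeRing r ℓ)
             (1+1≈0 : CommutativeRing._≈_ R (CommutativeRing._+_ R (CommutativeRing.1# R) (CommutativeRing.1# R))
                                            (CommutativeRing.0# R)) where

  open CommutativeRing R
  open import Algebra.Properties.CommutativeSemiring.Exp commutativeSemiring
    using (_^_; ^-congˡ; ^-congʳ; ^-homo-*; ^-assocʳ; ^-distrib-*)
  open import Relation.Binary.Reasoning.Setoid setoid

  private
    ⟦_⟧ : Bool → Carrier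
    ⟦ b ⟧ = if b then 1# else 0#

    -- Taking the solver's coefficients in F₂ makes doubled terms cancel, so that identities special
    -- to characteristic 2 are within its reach.
    fromBool : CommutativeRing.rawRing xor-∧-commutativeRing
               -Raw-AlmostCommutative⟶ fromCommutativeRing R
    fromBool = record
      { ⟦_⟧    = ⟦_⟧
      ; +-homo = +-homo
      ; *-homo = *-homo
      ; -‿homo = -‿homo
      ; 0-homo = refl
      ; 1-homo = refl
      }
      where
      open import Algebra.Properties.Ring ring using (-0#≈0#)
      open import Algebra.Properties.Group +-group using (inverseˡ-unique)
      module F₂ = CommutativeRing xor-∧-commutativeRing
      +-homo : ∀ a b → ⟦ a F₂.+ b ⟧ ≈ ⟦ a ⟧ + ⟦ b ⟧
      +-homo false b     = sym (+-identityˡ ⟦ b ⟧)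
      +-homo true  false = sym (+-identityʳ 1#)
      +-homo true  true  = sym 1+1≈0
      *-homo : ∀ a b → ⟦ a F₂.* b ⟧ ≈ ⟦ a ⟧ * ⟦ b ⟧
      *-homo false b = sym (zeroˡ ⟦ b ⟧)
      *-homo true  b = sym (*-identityˡ ⟦ b ⟧)
      -‿homo : ∀ a → ⟦ F₂.- a ⟧ ≈ - ⟦ a ⟧
      -‿homo false = sym -0#≈0#
      -‿homo true  = inverseˡ-unique 1# 1# 1+1≈0

    _≟-coefficient_ : WeaklyDecidable (Induced-equivalence fromBool)
    a ≟-coefficient b = map (λ a≡b → reflexive (≡.cong ⟦_⟧ a≡b)) (dec⇒maybe (a ≟ᵇ b))

    import Algebra.Solver.Ring _ (fromCommutativeRing R) fromBool _≟-coefficient_ as Solver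

  open Solver public using (solve; con; var; _:=_; _:+_; _:*_; _:^_)

  pattern :1 = con true

  x+y≈0⇒x≈y : ∀ x y → x + y ≈ 0# → x ≈ y
  x+y≈0⇒x≈y x y eq = begin
    x           ≈⟨ solve 2 (λ x y → x := (x :+ y) :+ y) refl x y ⟩
    (x + y) + y ≈⟨ +-congʳ eq ⟩
    0# + y      ≈⟨ +-identityˡ y ⟩
    y           ∎

  -- Finite pentagonal and triangular number theorems

  module ThetaSums (x : Carrier) where

    eulerProduct : ℕ → Carrier
    eulerProduct zero    = 1#
    eulerProduct (suc n) = eulerProduct n * (1# + x ^ suc n)

    -- With k = n + 1, the exponents k² + k(k-1)/2 and k² + k(k+1)/2 are the generalized pentagonal
    -- numbers k(3k-1)/2 and k(3k+1)/2.
    pentagonalSum : ℕ → Carrier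
    pentagonalSum zero    = 1#
    pentagonalSum (suc n) = pentagonalSum n + (x ^ suc n) ^ suc n * (x ^ triangular n + x ^ triangular (suc n))

    triangularSum : ℕ → Carrier
    triangularSum zero    = 0#
    triangularSum (suc n) = triangularSum n + x ^ triangular n

    x^[n*2] : ∀ n → x ^ (n ℕ.* 2) ≈ x ^ n * x ^ n
    x^[n*2] n = begin
      x ^ (n ℕ.* 2)        ≈⟨ ^-assocʳ x n 2 ⟨
      x ^ n * (x ^ n * 1#) ≈⟨ *-congˡ (*-identityʳ (x ^ n)) ⟩
      x ^ n * x ^ n        ∎

    -- Shanks's sum for the pentagonal number theorem: with e for eulerProduct,
    -- pentagonalShanks y s = Σ_{r ≤ s} (e s / e r) y^r x^{r(r+1)/2}.
    pentagonalShanks : Carrier → ℕ → Carrier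
    pentagonalShanks y zero    = 1#
    pentagonalShanks y (suc s) = (1# + x ^ suc s) * pentagonalShanks y s + y ^ suc s * x ^ triangular (suc s)

    -- For y = x ^ n and s = n, the factor `1# + x * y` is the one that the recursion of
    -- `pentagonalShanks` gains at `suc n`, so base and length can grow together. Keeping y
    -- independent of s is what makes induction on s possible.
    pentagonalShanks-shift : ∀ y s → (1# + x * y) * pentagonalShanks (x * y) s
                                     ≈ pentagonalShanks y s + (x * y) ^ suc s * x ^ triangular s
    pentagonalShanks-shift y zero =
      solve 2 (λ x y → (:1 :+ x :* y) :* :1 := :1 :+ (x :* y) :^ 1 :* :1) refl x y
    pentagonalShanks-shift y (suc s) = begin
      (1# + x * y) * ((1# + X) * h′ + (x * y) ^ suc s * x ^ triangular (suc s))
        ≈⟨ *-congˡ (+-congˡ (*-cong (^-distrib-* x y (suc s)) tX)) ⟩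
      (1# + x * y) * ((1# + X) * h′ + (X * Y) * (t * X))
        ≈⟨ solve 6 (λ x y X Y t h′ → (:1 :+ x :* y) :* ((:1 :+ X) :* h′ :+ (X :* Y) :* (t :* X))
             := (:1 :+ X) :* ((:1 :+ x :* y) :* h′) :+ (:1 :+ x :* y) :* ((X :* Y) :* (t :* X))) refl x y X Y t h′ ⟩
      (1# + X) * ((1# + x * y) * h′) + (1# + x * y) * ((X * Y) * (t * X))
        ≈⟨ +-congʳ (*-congˡ (trans (pentagonalShanks-shift y s) (+-congˡ (*-congʳ (^-distrib-* x y (suc s)))))) ⟩
      (1# + X) * (h + (X * Y) * t) + (1# + x * y) * ((X * Y) * (t * X))
        ≈⟨ solve 6 (λ x y X Y t h →
             (:1 :+ X) :* (h :+ (X :* Y) :* t) :+ (:1 :+ x :* y) :* ((X :* Y) :* (t :* X))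
             := (:1 :+ X) :* h :+ Y :* (t :* X) :+ (x :* y :* (X :* Y)) :* (t :* X)) refl x y X Y t h ⟩
      (1# + X) * h + Y * (t * X) + (x * y * (X * Y)) * (t * X)
        ≈⟨ +-cong (+-congˡ (*-congˡ tX)) (*-cong (*-congˡ (^-distrib-* x y (suc s))) tX) ⟨
      (1# + X) * h + Y * x ^ triangular (suc s) + (x * y) ^ suc (suc s) * x ^ triangular (suc s) ∎
      where
      X  = x ^ suc s
      Y  = y ^ suc s
      t  = x ^ triangular s
      h  = pentagonalShanks y s
      h′ = pentagonalShanks (x * y) s
      tX : x ^ triangular (suc s) ≈ t * X
      tX = ^-homo-* x (triangular s) (suc s)

    pentagonalShanks≈pentagonalSum : ∀ n → pentagonalShanks (x ^ n) n ≈ pentagonalSum n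
    pentagonalShanks≈pentagonalSum zero    = refl
    pentagonalShanks≈pentagonalSum (suc n) = begin
      (1# + x ^ suc n) * pentagonalShanks (x ^ suc n) n + (x ^ suc n) ^ suc n * x ^ triangular (suc n)
        ≈⟨ +-congʳ (pentagonalShanks-shift (x ^ n) n) ⟩
      pentagonalShanks (x ^ n) n + (x ^ suc n) ^ suc n * x ^ triangular n + (x ^ suc n) ^ suc n * x ^ triangular (suc n)
        ≈⟨ +-assoc _ _ _ ⟩
      pentagonalShanks (x ^ n) n + ((x ^ suc n) ^ suc n * x ^ triangular n + (x ^ suc n) ^ suc n * x ^ triangular (suc n))
        ≈⟨ +-cong (pentagonalShanks≈pentagonalSum n) (sym (distribˡ _ _ _)) ⟩
      pentagonalSum (suc n) ∎

    -- Every term of Shanks's sum with r ≥ 1 carries a factor y, and the term r = 0 is the product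
    -- itself.
    pentagonalShanks-mod : ∀ y s → ∃[ r ] pentagonalShanks y s ≈ eulerProduct s + y * r
    pentagonalShanks-mod y zero = 0# , solve 1 (λ y → :1 := :1 :+ y :* con false) refl y
    pentagonalShanks-mod y (suc s) with pentagonalShanks-mod y s
    ... | r , eq = _ , trans (+-congʳ (*-congˡ eq))
      (solve 6 (λ e y r X Y t → (:1 :+ X) :* (e :+ y :* r) :+ (y :* Y) :* t
                  := e :* (:1 :+ X) :+ y :* ((:1 :+ X) :* r :+ Y :* t))
        refl (eulerProduct s) y r (x ^ suc s) (y ^ s) (x ^ triangular (suc s)))

    pentagonalNumberTheorem : ∀ n → ∃[ r ] pentagonalSum n ≈ eulerProduct n + x ^ n * r
    pentagonalNumberTheorem n with pentagonalShanks-mod (x ^ n) n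
    ... | r , eq = r , trans (sym (pentagonalShanks≈pentagonalSum n)) eq

    oddProduct : ℕ → Carrier
    oddProduct zero    = 1#
    oddProduct (suc n) = oddProduct n * (1# + x ^ suc (n ℕ.* 2))

    -- The product up to 2n splits by parity of the exponent, and in characteristic 2 its even
    -- factors are 1 + x^{2k} = (1 + x^k)².
    oddProduct*eulerProduct² : ∀ n → oddProduct n * (eulerProduct n * eulerProduct n) ≈ eulerProduct (n ℕ.* 2)
    oddProduct*eulerProduct² zero    = solve 0 (:1 :* (:1 :* :1) := :1) refl
    oddProduct*eulerProduct² (suc n) = begin
      (o * (1# + w)) * ((e * (1# + X)) * (e * (1# + X)))
        ≈⟨ solve 4 (λ o w e X → (o :* (:1 :+ w)) :* ((e :* (:1 :+ X)) :* (e :* (:1 :+ X)))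
             := (o :* (e :* e)) :* (:1 :+ w) :* (:1 :+ X :* X)) refl o w e X ⟩
      (o * (e * e)) * (1# + w) * (1# + X * X)
        ≈⟨ *-cong (*-congʳ (oddProduct*eulerProduct² n)) (+-congˡ (sym (x^[n*2] (suc n)))) ⟩
      eulerProduct (suc n ℕ.* 2) ∎
      where
      o = oddProduct n
      e = eulerProduct n
      w = x ^ suc (n ℕ.* 2)
      X = x ^ suc n

    -- Shanks's sum for Gauss's triangular number theorem, cleared of denominators:
    -- with o for oddProduct and E m = ∏_{k ≤ m} (1 - x^{2k}),
    -- triangularShanks y s = Σ_{r ≤ s} (E s / E r) (o r) y^r.
    triangularShanks : Carrier → ℕ → Carrier
    triangularShanks y zero    = 1#
    triangularShanks y (suc s) = (1# + x ^ suc s * x ^ suc s) * triangularShanks y s + oddProduct (suc s) * y ^ suc s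

    -- For y = x^{2n+1} and s = n, the base moves to the next odd power; `1# + x * y` is then the
    -- factor gained by the recursion of `triangularShanks`, and `1# + y` the one gained by
    -- `oddProduct`.
    triangularShanks-shift : ∀ y s → (1# + x * y) * triangularShanks (x * (x * y)) s
                                     ≈ (1# + y) * triangularShanks y s + y ^ suc s * oddProduct (suc s)
    triangularShanks-shift y zero =
      solve 2 (λ x y → (:1 :+ x :* y) :* :1 := (:1 :+ y) :* :1 :+ y :^ 1 :* (:1 :* (:1 :+ x :^ 1))) refl x y
    triangularShanks-shift y (suc s) = begin
      (1# + x * y) * ((1# + X * X) * k′ + o * (x * (x * y)) ^ suc s)
        ≈⟨ *-congˡ (+-congˡ (*-congˡ (trans (^-distrib-* x (x * y) (suc s)) (*-congˡ (^-distrib-* x y (suc s)))))) ⟩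
      (1# + x * y) * ((1# + X * X) * k′ + o * (X * (X * Y)))
        ≈⟨ solve 6 (λ x y X Y o k′ → (:1 :+ x :* y) :* ((:1 :+ X :* X) :* k′ :+ o :* (X :* (X :* Y)))
             := (:1 :+ X :* X) :* ((:1 :+ x :* y) :* k′) :+ (:1 :+ x :* y) :* (o :* (X :* (X :* Y)))) refl x y X Y o k′ ⟩
      (1# + X * X) * ((1# + x * y) * k′) + (1# + x * y) * (o * (X * (X * Y)))
        ≈⟨ +-congʳ (*-congˡ (triangularShanks-shift y s)) ⟩
      (1# + X * X) * ((1# + y) * k + Y * o) + (1# + x * y) * (o * (X * (X * Y)))
        ≈⟨ solve 6 (λ x y X Y o k →
             (:1 :+ X :* X) :* ((:1 :+ y) :* k :+ Y :* o) :+ (:1 :+ x :* y) :* (o :* (X :* (X :* Y)))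
             := (:1 :+ y) :* ((:1 :+ X :* X) :* k :+ o :* Y) :+ (y :* Y) :* (o :* (:1 :+ x :* (X :* X)))) refl x y X Y o k ⟩
      (1# + y) * ((1# + X * X) * k + o * Y) + (y * Y) * (o * (1# + x * (X * X)))
        ≈⟨ +-congˡ (*-congˡ (*-congˡ (+-congˡ (*-congˡ (x^[n*2] (suc s)))))) ⟨
      (1# + y) * triangularShanks y (suc s) + y ^ suc (suc s) * oddProduct (suc (suc s)) ∎
      where
      X  = x ^ suc s
      Y  = y ^ suc s
      o  = oddProduct (suc s)
      k  = triangularShanks y s
      k′ = triangularShanks (x * (x * y)) s

    triangularShanks≈triangularSum : ∀ n → triangularShanks (x ^ suc (n ℕ.* 2)) n
                                           ≈ oddProduct n * triangularSum (suc (n ℕ.* 2))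
    triangularShanks≈triangularSum zero    = solve 0 (:1 := :1 :* (con false :+ :1)) refl
    triangularShanks≈triangularSum (suc n) = begin
      (1# + x ^ suc n * x ^ suc n) * triangularShanks z n + oddProduct (suc n) * z ^ suc n
        ≈⟨ +-congʳ (*-congʳ (+-congˡ (x^[n*2] (suc n)))) ⟨
      (1# + x * y) * triangularShanks z n + oddProduct (suc n) * z ^ suc n
        ≈⟨ +-congʳ (triangularShanks-shift y n) ⟩
      (1# + y) * triangularShanks y n + y ^ suc n * oddProduct (suc n) + oddProduct (suc n) * z ^ suc n
        ≈⟨ +-congʳ (+-congʳ (*-congˡ (triangularShanks≈triangularSum n))) ⟩
      (1# + y) * (oddProduct n * t) + y ^ suc n * oddProduct (suc n) + oddProduct (suc n) * z ^ suc n
        ≈⟨ solve 5 (λ y o t Y Z → (:1 :+ y) :* (o :* t) :+ Y :* (o :* (:1 :+ y)) :+ o :* (:1 :+ y) :* Z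
             := o :* (:1 :+ y) :* (t :+ Y :+ Z)) refl y (oddProduct n) t (y ^ suc n) (z ^ suc n) ⟩
      oddProduct (suc n) * (t + y ^ suc n + z ^ suc n)
        -- The exponents (2n+1)(n+1) and (2n+3)(n+1) are the triangular numbers of index 2n+1 and
        -- 2n+2, so the sum grows by two terms.
        ≈⟨ *-congˡ (+-cong (+-congˡ (power (1 ℕ.+ n ℕ.* 2) (triangular-1+2m n))) (power (3 ℕ.+ n ℕ.* 2) (triangular-2+2m n))) ⟩
      oddProduct (suc n) * triangularSum (suc (suc n ℕ.* 2)) ∎
      where
      y = x ^ suc (n ℕ.* 2)
      z = x ^ suc (suc n ℕ.* 2)
      t = triangularSum (suc (n ℕ.* 2))
      power : ∀ i {j} → j ≡ i ℕ.* suc n → (x ^ i) ^ suc n ≈ x ^ j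
      power i eq = trans (^-assocʳ x i (suc n)) (^-congʳ x (≡.sym eq))

    triangularShanks-mod : ∀ y s → ∃[ r ] triangularShanks y s ≈ eulerProduct s * eulerProduct s + y * r
    triangularShanks-mod y zero = 0# , solve 1 (λ y → :1 := :1 :* :1 :+ y :* con false) refl y
    triangularShanks-mod y (suc s) with triangularShanks-mod y s
    ... | r , eq = _ , trans (+-congʳ (*-congˡ eq))
      (solve 6 (λ e y r X Y o → (:1 :+ X :* X) :* (e :* e :+ y :* r) :+ o :* (y :* Y)
                  := e :* (:1 :+ X) :* (e :* (:1 :+ X)) :+ y :* ((:1 :+ X :* X) :* r :+ o :* Y))
        refl (eulerProduct s) y r (x ^ suc s) (y ^ s) (oddProduct (suc s)))

    -- Gauss: ∏ (1 - x^{2k})² = ∏ (1 - x^k) · Σ x^{r(r+1)/2}, where 1 - x^{2k} = (1 - x^k)².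
    triangularNumberTheorem : ∀ n → ∃[ r ] eulerProduct n ^ 4 + x ^ n * r
                                           ≈ eulerProduct (n ℕ.* 2) * triangularSum (suc (n ℕ.* 2))
    triangularNumberTheorem n with triangularShanks-mod (x ^ suc (n ℕ.* 2)) n
    ... | r , eq = _ , (begin
      e ^ 4 + X * (x * X * r * (e * e))
        ≈⟨ solve 4 (λ e X x r → e :^ 4 :+ X :* (x :* X :* r :* (e :* e))
             := (e :* e :+ (x :* (X :* X)) :* r) :* (e :* e)) refl e X x r ⟩
      (e * e + (x * (X * X)) * r) * (e * e)
        ≈⟨ *-congʳ (+-congˡ (*-congʳ (*-congˡ (x^[n*2] n)))) ⟨
      (e * e + x ^ suc (n ℕ.* 2) * r) * (e * e)
        ≈⟨ *-congʳ eq ⟨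
      triangularShanks (x ^ suc (n ℕ.* 2)) n * (e * e)
        ≈⟨ *-congʳ (triangularShanks≈triangularSum n) ⟩
      (o * t) * (e * e)
        ≈⟨ solve 3 (λ o t e → (o :* t) :* (e :* e) := (o :* (e :* e)) :* t) refl o t e ⟩
      (o * (e * e)) * t
        ≈⟨ *-congʳ (oddProduct*eulerProduct² n) ⟩
      eulerProduct (n ℕ.* 2) * t ∎)
      where
      e = eulerProduct n
      X = x ^ n
      o = oddProduct n
      t = triangularSum (suc (n ℕ.* 2))

  -- Dissection modulo 3 and the algebra of the level 6 relation

  open ThetaSums

  -- After index 0, which gives the leading 1, indices come in blocks 3m+1, 3m+2, 3m+3. The first
  -- gives a triangular term in x ^ 9 times x, and the other two form one pentagonal pair in x ^ 3.
  triangularSum-dissection : ∀ x m → triangularSum x (suc (m ℕ.* 3))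
                                     ≈ pentagonalSum (x ^ 3) m + x * triangularSum (x ^ 9) m
  triangularSum-dissection x zero = solve 1 (λ x → con false :+ :1 := :1 :+ x :* con false) refl x
  triangularSum-dissection x (suc m) = begin
    triangularSum x (suc (m ℕ.* 3)) + x ^ triangular (1 ℕ.+ m ℕ.* 3)
      + x ^ triangular (2 ℕ.+ m ℕ.* 3) + x ^ triangular (3 ℕ.+ m ℕ.* 3)
      ≈⟨ +-cong (+-cong (+-cong (triangularSum-dissection x m) middle) (outer m (triangular-2+3m m)))
                (outer (suc m) (triangular-3+3m m)) ⟩
    p + x * t + x * a + s * b + s * c
      ≈⟨ solve 7 (λ x p t a s b c → p :+ x :* t :+ x :* a :+ s :* b :+ s :* c
           := (p :+ s :* (b :+ c)) :+ x :* (t :+ a)) refl x p t a s b c ⟩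
    p + s * (b + c) + x * (t + a) ∎
    where
    p = pentagonalSum (x ^ 3) m
    t = triangularSum (x ^ 9) m
    a = (x ^ 9) ^ triangular m
    s = ((x ^ 3) ^ suc m) ^ suc m
    b = (x ^ 3) ^ triangular m
    c = (x ^ 3) ^ triangular (suc m)
    middle : x ^ triangular (1 ℕ.+ m ℕ.* 3) ≈ x * a
    middle = trans (^-congʳ x (triangular-1+3m m)) (*-congˡ (sym (^-assocʳ x 9 (triangular m))))
    outer : ∀ k {j} → j ≡ 3 ℕ.* (suc m ℕ.* suc m) ℕ.+ 3 ℕ.* triangular k →
          x ^ j ≈ s * (x ^ 3) ^ triangular k
    outer k {j} eq = begin
      x ^ j ≈⟨ ^-congʳ x eq ⟩
      x ^ (3 ℕ.* (suc m ℕ.* suc m) ℕ.+ 3 ℕ.* triangular k) ≈⟨ ^-homo-* x (3 ℕ.* (suc m ℕ.* suc m)) _ ⟩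
      x ^ (3 ℕ.* (suc m ℕ.* suc m)) * x ^ (3 ℕ.* triangular k)
        ≈⟨ *-cong (trans (sym (^-assocʳ x 3 (suc m ℕ.* suc m))) (sym (^-assocʳ (x ^ 3) (suc m) (suc m))))
                  (sym (^-assocʳ x 3 (triangular k))) ⟩
      s * (x ^ 3) ^ triangular k ∎

  -- Here a, b, c stand for E d, E (3d), E (9d), x for q^d, and below i, j for 1 / a, 1 / b.
  module _ {x a b c : Carrier} (a³ : a ^ 3 ≈ b + x * c ^ 3) where

    a¹² : a ^ 12 ≈ b ^ 4 + x ^ 4 * c ^ 12
    a¹² = begin
      a ^ 12                   ≈⟨ solve 1 (λ a → a :^ 12 := (a :^ 3) :^ 4) refl a ⟩
      (a ^ 3) ^ 4              ≈⟨ ^-congˡ 4 a³ ⟩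
      (b + x * c ^ 3) ^ 4      ≈⟨ solve 3 (λ x b c → (b :+ x :* c :^ 3) :^ 4 := b :^ 4 :+ x :^ 4 :* c :^ 12) refl x b c ⟩
      b ^ 4 + x ^ 4 * c ^ 12   ∎

    -- Once `a ^ 3` and `a ^ 12` are substituted, `b ^ 4` occurs twice and cancels; every remaining
    -- term has a factor x.
    level6-descent : a ^ 3 * b ^ 3 + (a ^ 12 + x * b ^ 12) ≈ x * (b ^ 3 * c ^ 3 + (b ^ 12 + x ^ 3 * c ^ 12))
    level6-descent = begin
      a ^ 3 * b ^ 3 + (a ^ 12 + x * b ^ 12)
        ≈⟨ +-cong (*-congʳ a³) (+-congʳ a¹²) ⟩
      (b + x * c ^ 3) * b ^ 3 + (b ^ 4 + x ^ 4 * c ^ 12 + x * b ^ 12)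
        ≈⟨ solve 3 (λ x b c → (b :+ x :* c :^ 3) :* b :^ 3 :+ (b :^ 4 :+ x :^ 4 :* c :^ 12 :+ x :* b :^ 12)
             := x :* (b :^ 3 :* c :^ 3 :+ (b :^ 12 :+ x :^ 3 :* c :^ 12))) refl x b c ⟩
      x * (b ^ 3 * c ^ 3 + (b ^ 12 + x ^ 3 * c ^ 12)) ∎

    module _ {i j : Carrier} (ai≈1 : a * i ≈ 1#) (bj≈1 : b * j ≈ 1#) where

      private
        u = a ^ 3 * j ^ 3
        v = b ^ 3 * i ^ 3

      a³/b³ : u ≈ j * j + x * (c ^ 3 * j ^ 3)
      a³/b³ = begin
        a ^ 3 * j ^ 3
          ≈⟨ *-congʳ a³ ⟩
        (b + x * c ^ 3) * j ^ 3
          ≈⟨ solve 4 (λ x b c j → (b :+ x :* c :^ 3) :* j :^ 3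
               := (b :* j) :* (j :* j) :+ x :* (c :^ 3 :* j :^ 3)) refl x b c j ⟩
        (b * j) * (j * j) + x * (c ^ 3 * j ^ 3)
          ≈⟨ +-congʳ (trans (*-congʳ bj≈1) (*-identityˡ (j * j))) ⟩
        j * j + x * (c ^ 3 * j ^ 3) ∎

      module _ (a³b³ : a ^ 3 * b ^ 3 ≈ a ^ 12 + x * b ^ 12) where

        -- Here `a * a` and `j * j` stand for E 2 and 1 / E 6. After cancelling a with i and b with
        -- j, the cube is a³ b³ / b¹².
        j₆-quotient : (((a * a) * b ^ 3) * (i * (j * j) ^ 3)) ^ 3 ≈ (u * u) * (u * u) + x
        j₆-quotient = begin
          (((a * a) * b ^ 3) * (i * (j * j) ^ 3)) ^ 3
            ≈⟨ solve 4 (λ a b i j → (((a :* a) :* b :^ 3) :* (i :* (j :* j) :^ 3)) :^ 3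
                 := (a :^ 3 :* b :^ 3) :* j :^ 12 :* ((a :* i) :^ 3 :* (b :* j) :^ 6)) refl a b i j ⟩
          (a ^ 3 * b ^ 3) * j ^ 12 * ((a * i) ^ 3 * (b * j) ^ 6)
            ≈⟨ *-cong (*-congʳ a³b³) (*-cong (^-congˡ 3 ai≈1) (^-congˡ 6 bj≈1)) ⟩
          (a ^ 12 + x * b ^ 12) * j ^ 12 * (1# ^ 3 * 1# ^ 6)
            ≈⟨ solve 4 (λ x a b j → (a :^ 12 :+ x :* b :^ 12) :* j :^ 12 :* (:1 :^ 3 :* :1 :^ 6)
                 := (a :^ 3 :* j :^ 3) :^ 4 :+ x :* (b :* j) :^ 12) refl x a b j ⟩
          u ^ 4 + x * (b * j) ^ 12
            ≈⟨ +-congˡ (*-congˡ (^-congˡ 12 bj≈1)) ⟩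
          u ^ 4 + x * 1# ^ 12
            ≈⟨ solve 2 (λ x u → u :^ 4 :+ x :* :1 :^ 12 := (u :* u) :* (u :* u) :+ x) refl x u ⟩
          (u * u) * (u * u) + x ∎

        -- The sixth power is (a³ b³)² / (a b)¹². The result is left as a nested square so that each
        -- squaring can later be read as a dilation.
        j₆*-quotient : ((a * b) * ((i * i) * (j * j))) ^ 6 ≈ (u * u + x * (v * v)) * (u * u + x * (v * v))
        j₆*-quotient = begin
          ((a * b) * ((i * i) * (j * j))) ^ 6
            ≈⟨ solve 4 (λ a b i j → ((a :* b) :* ((i :* i) :* (j :* j))) :^ 6
                 := (a :^ 3 :* b :^ 3) :^ 2 :* (i :* j) :^ 12) refl a b i j ⟩
          (a ^ 3 * b ^ 3) ^ 2 * (i * j) ^ 12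
            ≈⟨ *-congʳ (^-congˡ 2 a³b³) ⟩
          (a ^ 12 + x * b ^ 12) ^ 2 * (i * j) ^ 12
            ≈⟨ solve 5 (λ x a b i j → (a :^ 12 :+ x :* b :^ 12) :^ 2 :* (i :* j) :^ 12
                 := (a :^ 3 :* j :^ 3) :^ 4 :* (a :* i) :^ 12 :+ x :^ 2 :* (b :^ 3 :* i :^ 3) :^ 4 :* (b :* j) :^ 12)
                 refl x a b i j ⟩
          u ^ 4 * (a * i) ^ 12 + x ^ 2 * v ^ 4 * (b * j) ^ 12
            ≈⟨ +-cong (*-congˡ (^-congˡ 12 ai≈1)) (*-congˡ (^-congˡ 12 bj≈1)) ⟩
          u ^ 4 * 1# ^ 12 + x ^ 2 * v ^ 4 * 1# ^ 12
            ≈⟨ solve 3 (λ x u v → u :^ 4 :* :1 :^ 12 :+ x :^ 2 :* v :^ 4 :* :1 :^ 12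
                 := (u :* u :+ x :* (v :* v)) :* (u :* u :+ x :* (v :* v))) refl x u v ⟩
          (u * u + x * (v * v)) * (u * u + x * (v * v)) ∎

-- Formal power series over F₂

module F₂Solver = Char2 xor-∧-commutativeRing ≡.refl

module PowerSeries where

  open F₂Solver using (solve; con; var; _:=_; _:+_; _:*_)
  open ≡.≡-Reasoning

  infixl 7 _*_

  -- The left factor is split as f 0 + q (f ∘ suc), so that proofs can go by induction on the
  -- exponent, with f replaced by its tail.
  _*_ : (ℕ → Bool) → (ℕ → Bool) → (ℕ → Bool)
  (f * g) zero    = f 0 ∧ g 0
  (f * g) (suc n) = f 0 ∧ g (suc n) xor (f ∘ suc * g) n

  unit : ℕ → Bool
  unit = 0 ≡ᵇ_

  *-cong-≤ : ∀ {f f′ g g′} n → (∀ {i} → i ≤ n → f i ≡ f′ i) → (∀ {i} → i ≤ n → g i ≡ g′ i) →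
             (f * g) n ≡ (f′ * g′) n
  *-cong-≤ zero    f≡ g≡ = ≡.cong₂ _∧_ (f≡ z≤n) (g≡ z≤n)
  *-cong-≤ (suc n) f≡ g≡ = ≡.cong₂ _xor_ (≡.cong₂ _∧_ (f≡ z≤n) (g≡ ℕ.≤-refl))
    (*-cong-≤ n (f≡ ∘ s≤s) (g≡ ∘ ℕ.m≤n⇒m≤1+n))

  *-cong : ∀ {f f′ g g′} → f ≗ f′ → g ≗ g′ → f * g ≗ f′ * g′
  *-cong f≗ g≗ n = *-cong-≤ n (λ {i} _ → f≗ i) (λ {i} _ → g≗ i)

  *-sucʳ : ∀ f g n → (f * g) (suc n) ≡ (f * (g ∘ suc)) n xor f (suc n) ∧ g 0
  *-sucʳ f g zero    = ≡.refl
  *-sucʳ f g (suc n) = ≡.trans (≡.cong (f 0 ∧ g (suc (suc n)) xor_) (*-sucʳ (f ∘ suc) g n))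
                               (≡.sym (xor-assoc (f 0 ∧ g (suc (suc n))) _ _))

  *-comm : ∀ f g → f * g ≗ g * f
  *-comm f g zero    = ∧-comm (f 0) (g 0)
  *-comm f g (suc n) = begin
    f 0 ∧ g (suc n) xor (f ∘ suc * g) n ≡⟨ ≡.cong₂ _xor_ (∧-comm (f 0) _) (*-comm (f ∘ suc) g n) ⟩
    g (suc n) ∧ f 0 xor (g * (f ∘ suc)) n ≡⟨ xor-comm (g (suc n) ∧ f 0) _ ⟩
    (g * (f ∘ suc)) n xor g (suc n) ∧ f 0 ≡⟨ *-sucʳ g f n ⟨
    (g * f) (suc n) ∎

  -- The tail of a product is a scalar multiple of one series plus another; associativity has to
  -- multiply out exactly this combination.
  *-linearˡ : ∀ b f g h → (λ n → b ∧ f n xor g n) * h ≗ λ n → b ∧ (f * h) n xor (g * h) n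
  *-linearˡ b f g h zero =
    solve 4 (λ b x y z → (b :* x :+ y) :* z := b :* (x :* z) :+ y :* z) ≡.refl b (f 0) (g 0) (h 0)
  *-linearˡ b f g h (suc n) = ≡.trans
    (≡.cong ((b ∧ f 0 xor g 0) ∧ h (suc n) xor_) (*-linearˡ b (f ∘ suc) (g ∘ suc) h n))
    (solve 6 (λ b x y z u v → (b :* x :+ y) :* z :+ (b :* u :+ v) := b :* (x :* z :+ u) :+ (y :* z :+ v))
      ≡.refl b (f 0) (g 0) (h (suc n)) ((f ∘ suc * h) n) ((g ∘ suc * h) n))

  *-assoc : ∀ f g h → (f * g) * h ≗ f * (g * h)
  *-assoc f g h zero    = solve 3 (λ x y z → x :* y :* z := x :* (y :* z)) ≡.refl (f 0) (g 0) (h 0)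
  *-assoc f g h (suc n) = begin
    (f 0 ∧ g 0) ∧ h (suc n) xor ((λ m → f 0 ∧ g (suc m) xor (f ∘ suc * g) m) * h) n
      ≡⟨ ≡.cong ((f 0 ∧ g 0) ∧ h (suc n) xor_) (*-linearˡ (f 0) (g ∘ suc) (f ∘ suc * g) h n) ⟩
    (f 0 ∧ g 0) ∧ h (suc n) xor (f 0 ∧ (g ∘ suc * h) n xor (f ∘ suc * g * h) n)
      ≡⟨ ≡.cong (λ t → (f 0 ∧ g 0) ∧ h (suc n) xor (f 0 ∧ (g ∘ suc * h) n xor t)) (*-assoc (f ∘ suc) g h n) ⟩
    (f 0 ∧ g 0) ∧ h (suc n) xor (f 0 ∧ (g ∘ suc * h) n xor (f ∘ suc * (g * h)) n)
      ≡⟨ solve 5 (λ x y z u v → x :* y :* z :+ (x :* u :+ v) := x :* (y :* z :+ u) :+ v)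
           ≡.refl (f 0) (g 0) (h (suc n)) _ _ ⟩
    (f * (g * h)) (suc n) ∎

  *-zeroˡ : ∀ f → (λ _ → false) * f ≗ λ _ → false
  *-zeroˡ f zero    = ≡.refl
  *-zeroˡ f (suc n) = *-zeroˡ f n

  *-identityˡ : ∀ f → unit * f ≗ f
  *-identityˡ f zero    = ≡.refl
  *-identityˡ f (suc n) = ≡.trans (≡.cong (f (suc n) xor_) (*-zeroˡ f n)) (xor-identityʳ _)

  *-distribʳ : ∀ h f g → (λ n → f n xor g n) * h ≗ λ n → (f * h) n xor (g * h) n
  *-distribʳ h f g = *-linearˡ true f g h

  -- The dilation f(q) ↦ f(q^{e+1}); spread e c f is q^c f(q^{e+1}).
  spread : (e c : ℕ) → (ℕ → Bool) → (ℕ → Bool)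
  spread e zero    f zero    = f 0
  spread e zero    f (suc n) = spread e e (f ∘ suc) n
  spread e (suc c) f zero    = false
  spread e (suc c) f (suc n) = spread e c f n

  dilate : ℕ → (ℕ → Bool) → (ℕ → Bool)
  dilate e = spread e 0

  spread-linear : ∀ e c b f g → spread e c (λ n → b ∧ f n xor g n) ≗ λ n → b ∧ spread e c f n xor spread e c g n
  spread-linear e zero    b f g zero    = ≡.refl
  spread-linear e zero    b f g (suc n) = spread-linear e e b (f ∘ suc) (g ∘ suc) n
  spread-linear e (suc c) b f g zero    = ≡.sym (≡.trans (xor-identityʳ _) (∧-zeroʳ b))
  spread-linear e (suc c) b f g (suc n) = spread-linear e c b f g n

  spread-* : ∀ e c f g → spread e c (f * g) ≗ spread e c f * dilate e g
  spread-* e zero    f g zero    = ≡.refl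
  spread-* e zero    f g (suc n) = ≡.trans (spread-linear e e (f 0) (g ∘ suc) (f ∘ suc * g) n)
    (≡.cong (f 0 ∧ spread e e (g ∘ suc) n xor_) (spread-* e e (f ∘ suc) g n))
  spread-* e (suc c) f g zero    = ≡.refl
  spread-* e (suc c) f g (suc n) = spread-* e c f g n

  spread-0 : ∀ e c → spread e c (λ _ → false) ≗ (λ _ → false)
  spread-0 e zero    zero    = ≡.refl
  spread-0 e zero    (suc n) = spread-0 e e n
  spread-0 e (suc c) zero    = ≡.refl
  spread-0 e (suc c) (suc n) = spread-0 e c n

  -- The products f i · f j and f j · f i cancel for i ≠ j. The induction removes the outermost such
  -- pair by splitting once from each end.
  frobenius : ∀ f → f * f ≗ dilate 1 f
  frobenius f zero          = ∧-idem (f 0)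
  frobenius f (suc zero)    = ≡.trans (≡.cong (_xor f 1 ∧ f 0) (∧-comm (f 0) (f 1))) (xor-same (f 1 ∧ f 0))
  frobenius f (suc (suc n)) = begin
    a xor (f ∘ suc * f) (suc n)                    ≡⟨ ≡.cong (a xor_) (*-sucʳ (f ∘ suc) f n) ⟩
    a xor ((f ∘ suc * f ∘ suc) n xor f (suc (suc n)) ∧ f 0)
      ≡⟨ solve 3 (λ x y s → x :* y :+ (s :+ y :* x) := s) ≡.refl (f 0) (f (suc (suc n))) ((f ∘ suc * f ∘ suc) n) ⟩
    (f ∘ suc * f ∘ suc) n                          ≡⟨ frobenius (f ∘ suc) n ⟩
    dilate 1 f (suc (suc n))                       ∎
    where
    a = f 0 ∧ f (suc (suc n))

  commutativeRing : CommutativeRing _ _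
  commutativeRing = record
    { isCommutativeRing = record
      { isRing = record
        { +-isAbelianGroup = isAbelianGroup
        ; *-cong           = *-cong
        ; *-assoc          = *-assoc
        ; *-identity       = comm∧idˡ⇒id *-comm *-identityˡ
        ; distrib          = comm∧distrʳ⇒distr
            (λ f≗ g≗ n → ≡.cong₂ _xor_ (f≗ n) (g≗ n)) *-comm *-distribʳ
        }
      ; *-comm = *-comm
      }
    }
    where
    open AbelianGroup (Pointwise.abelianGroup ℕ (CommutativeRing.+-abelianGroup xor-∧-commutativeRing))
    open import Algebra.Consequences.Setoid setoid using (comm∧idˡ⇒id; comm∧distrʳ⇒distr)

-- Parity of integers

odd : ℕ → Bool
odd zero    = false
odd (suc n) = not (odd n)

odd-+ : ∀ m n → odd (m ℕ.+ n) ≡ odd m xor odd n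
odd-+ zero    n = ≡.refl
odd-+ (suc m) n = begin
  not (odd (m ℕ.+ n))        ≡⟨ true-xor _ ⟨
  true xor odd (m ℕ.+ n)     ≡⟨ ≡.cong (true xor_) (odd-+ m n) ⟩
  true xor (odd m xor odd n) ≡⟨ xor-assoc true (odd m) (odd n) ⟨
  not (odd m) xor odd n      ∎
  where open ≡.≡-Reasoning

odd-* : ∀ m n → odd (m ℕ.* n) ≡ odd m ∧ odd n
odd-* zero    n = ≡.refl
odd-* (suc m) n = begin
  odd (n ℕ.+ m ℕ.* n)           ≡⟨ odd-+ n (m ℕ.* n) ⟩
  odd n xor odd (m ℕ.* n)       ≡⟨ ≡.cong (odd n xor_) (odd-* m n) ⟩
  odd n xor odd m ∧ odd n       ≡⟨ ∧-distribʳ-xor (odd n) true (odd m) ⟨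
  not (odd m) ∧ odd n           ∎
  where open ≡.≡-Reasoning

even⇒2∣ : ∀ n → odd n ≡ false → 2 ℕ.∣ n
even⇒2∣ zero          _  = ℕ.divides 0 ≡.refl
even⇒2∣ (suc (suc n)) eq = ℕ.∣m∣n⇒∣m+n (ℕ.divides 1 ≡.refl)
  (even⇒2∣ n (≡.trans (≡.sym (not-involutive (odd n))) eq))

parity : ℤ → Bool
parity i = odd ℤ.∣ i ∣

parity-⊖ : ∀ m n → parity (m ⊖ n) ≡ odd m xor odd n
parity-⊖ m       zero    = ≡.sym (xor-identityʳ (odd m))
parity-⊖ zero    (suc n) = ≡.refl
parity-⊖ (suc m) (suc n) = begin
  parity (suc m ⊖ suc n)    ≡⟨ ≡.cong parity (ℤ.[1+m]⊖[1+n]≡m⊖n m n) ⟩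
  parity (m ⊖ n)            ≡⟨ parity-⊖ m n ⟩
  odd m xor odd n           ≡⟨ solve 2 (λ a b → a :+ b := (con true :+ a) :+ (con true :+ b)) ≡.refl (odd m) (odd n) ⟩
  (true xor odd m) xor (true xor odd n) ∎
  where
  open ≡.≡-Reasoning
  open F₂Solver

parity-+ : ∀ i j → parity (i ℤ.+ j) ≡ parity i xor parity j
parity-+ (+ m)    (+ n)    = odd-+ m n
parity-+ (+ m)    -[1+ n ] = parity-⊖ m (suc n)
parity-+ -[1+ m ] (+ n)    = ≡.trans (parity-⊖ n (suc m)) (xor-comm (odd n) _)
parity-+ -[1+ m ] -[1+ n ] = ≡.trans (≡.cong (odd ∘ suc) (≡.sym (ℕ.+-suc m n))) (odd-+ (suc m) (suc n))

parity-* : ∀ i j → parity (i ℤ.* j) ≡ parity i ∧ parity j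
parity-* i j = ≡.trans (≡.cong odd (ℤ.abs-* i j)) (odd-* ℤ.∣ i ∣ ℤ.∣ j ∣)

parity-neg : ∀ i → parity (ℤ.- i) ≡ parity i
parity-neg i = ≡.cong odd (ℤ.∣-i∣≡∣i∣ i)

parity⇒2∣ : ∀ i → parity i ≡ false → + 2 ∣ i
parity⇒2∣ i = even⇒2∣ ℤ.∣ i ∣

parity-≡⇒2∣ : ∀ i j → parity i ≡ parity j → + 2 ∣ i ℤ.- j
parity-≡⇒2∣ i j eq = parity⇒2∣ (i ℤ.- j) (≡.trans (parity-+ i (ℤ.- j))
  (≡.trans (≡.cong₂ _xor_ eq (parity-neg j)) (xor-same (parity j))))

-- Reduction of integer series modulo 2

module ModTwo where

  open PowerSeries
    using (*-cong-≤; spread; dilate; spread-linear; spread-*; spread-0; frobenius)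

  F₂⟦q⟧ : CommutativeRing _ _
  F₂⟦q⟧ = PowerSeries.commutativeRing

  open CommutativeRing F₂⟦q⟧
    using (_≈_; _+_; _*_; 0#; 1#; refl; sym; trans; setoid; +-cong; +-congˡ; +-congʳ; *-cong; *-congˡ; *-congʳ;
           +-identityʳ; *-assoc; *-comm; *-identityˡ; *-identityʳ; zeroˡ; zeroʳ; distribˡ)
    renaming (Carrier to F₂Series)

  1+1≈0 : 1# + 1# ≈ 0#
  1+1≈0 n = xor-same (1# n)

  open Char2 F₂⟦q⟧ 1+1≈0
    using (module ThetaSums; x+y≈0⇒x≈y; triangularSum-dissection; level6-descent; a³/b³; j₆-quotient; j₆*-quotient)
  open ThetaSums
  open import Algebra.Properties.CommutativeSemiring.Exp (CommutativeRing.commutativeSemiring F₂⟦q⟧)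
    using (_^_; ^-congˡ; ^-congʳ; ^-assocʳ)

  infix 4 _≈[_]_

  ⟦_⟧ : Series → F₂Series
  ⟦ f ⟧ n = parity (f n)

  -- The local recursion of Defs.mul has no name of its own: it is recovered here by unification.
  mutual
    partialSum : Series → Series → ℕ → ℕ → ℤ
    partialSum = _

    mul-suc : ∀ f g n → mul f g (suc n) ≡ f (suc n) ℤ.* g (n ∸ n) ℤ.+ partialSum f g (suc n) n
    mul-suc f g n with suc n
    ... | m = ≡.refl

  parity-partialSum : ∀ f g n k → parity (partialSum f g (suc n) (suc k))
                                  ≡ ⟦ f ⟧ 0 ∧ ⟦ g ⟧ (suc n) xor parity (partialSum (f ∘ suc) g n k)
  parity-partialSum f g n zero = begin
    parity (f 1 ℤ.* g n ℤ.+ f 0 ℤ.* g (suc n))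
      ≡⟨ parity-+ (f 1 ℤ.* g n) (f 0 ℤ.* g (suc n)) ⟩
    parity (f 1 ℤ.* g n) xor parity (f 0 ℤ.* g (suc n))
      ≡⟨ xor-comm _ (parity (f 0 ℤ.* g (suc n))) ⟩
    parity (f 0 ℤ.* g (suc n)) xor parity (f 1 ℤ.* g n)
      ≡⟨ ≡.cong (_xor parity (f 1 ℤ.* g n)) (parity-* (f 0) (g (suc n))) ⟩
    ⟦ f ⟧ 0 ∧ ⟦ g ⟧ (suc n) xor parity (f 1 ℤ.* g n) ∎
    where open ≡.≡-Reasoning
  parity-partialSum f g n (suc k) = begin
    parity (t ℤ.+ partialSum f g (suc n) (suc k))
      ≡⟨ parity-+ t _ ⟩
    parity t xor parity (partialSum f g (suc n) (suc k))
      ≡⟨ ≡.cong (parity t xor_) (parity-partialSum f g n k) ⟩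
    parity t xor (x xor parity s)
      ≡⟨ solve 3 (λ t x s → t :+ (x :+ s) := x :+ (t :+ s)) ≡.refl (parity t) x (parity s) ⟩
    x xor (parity t xor parity s)
      ≡⟨ ≡.cong (x xor_) (parity-+ t s) ⟨
    x xor parity (t ℤ.+ s) ∎
    where
    open ≡.≡-Reasoning
    open F₂Solver
    t = f (suc (suc k)) ℤ.* g (n ∸ suc k)
    s = partialSum (f ∘ suc) g n k
    x = ⟦ f ⟧ 0 ∧ ⟦ g ⟧ (suc n)

  ⟦mul⟧ : ∀ f g → ⟦ mul f g ⟧ ≈ ⟦ f ⟧ * ⟦ g ⟧
  ⟦mul⟧ f g zero    = parity-* (f 0) (g 0)
  ⟦mul⟧ f g (suc n) = ≡.trans (parity-partialSum f g n n)
    (≡.cong (⟦ f ⟧ 0 ∧ ⟦ g ⟧ (suc n) xor_) (⟦mul⟧ (f ∘ suc) g n))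

  ⟦one⟧ : ⟦ one ⟧ ≈ 1#
  ⟦one⟧ zero    = ≡.refl
  ⟦one⟧ (suc n) = ≡.refl

  ⟦pow⟧ : ∀ f n → ⟦ pow f n ⟧ ≈ ⟦ f ⟧ ^ n
  ⟦pow⟧ f zero    = ⟦one⟧
  ⟦pow⟧ f (suc n) = trans (⟦mul⟧ (pow f n) f) (trans (*-comm ⟦ pow f n ⟧ ⟦ f ⟧) (*-congˡ {⟦ f ⟧} (⟦pow⟧ f n)))

  -- Congruence modulo a power of q

  _≈[_]_ : F₂Series → ℕ → F₂Series → Set
  f ≈[ n ] g = ∀ {i} → i < n → f i ≡ g i

  module _ {n : ℕ} where
    ≈[]-trans : ∀ {f g h} → f ≈[ n ] g → g ≈[ n ] h → f ≈[ n ] h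
    ≈[]-trans p q i<n = ≡.trans (p i<n) (q i<n)

    ≈[]-sym : ∀ {f g} → f ≈[ n ] g → g ≈[ n ] f
    ≈[]-sym p i<n = ≡.sym (p i<n)

    ≈⇒≈[] : ∀ {f g} → f ≈ g → f ≈[ n ] g
    ≈⇒≈[] p {i} _ = p i

    +-cong-≈[] : ∀ {f f′ g g′} → f ≈[ n ] f′ → g ≈[ n ] g′ → f + g ≈[ n ] f′ + g′
    +-cong-≈[] p q i<n = ≡.cong₂ _xor_ (p i<n) (q i<n)

    *-cong-≈[] : ∀ {f f′ g g′} → f ≈[ n ] f′ → g ≈[ n ] g′ → f * g ≈[ n ] f′ * g′
    *-cong-≈[] p q {i} i<n = *-cong-≤ i (λ j≤i → p (ℕ.≤-<-trans j≤i i<n)) (λ j≤i → q (ℕ.≤-<-trans j≤i i<n))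

    ^-cong-≈[] : ∀ {f g} k → f ≈[ n ] g → f ^ k ≈[ n ] g ^ k
    ^-cong-≈[] zero    p _ = ≡.refl
    ^-cong-≈[] (suc k) p = *-cong-≈[] p (^-cong-≈[] k p)

  ≈[]-setoid : ℕ → Setoid _ _
  ≈[]-setoid n = record
    { Carrier       = F₂Series
    ; _≈_           = _≈[ n ]_
    ; isEquivalence = record
      { refl  = λ _ → ≡.refl
      ; sym   = λ p → ≈[]-sym p
      ; trans = λ p q → ≈[]-trans p q
      }
    }

  module ≈[]-Reasoning (n : ℕ) where
    open import Relation.Binary.Reasoning.Setoid (≈[]-setoid n) public

  ≈[]-weaken : ∀ {m n f g} → m ≤ n → f ≈[ n ] g → f ≈[ m ] g
  ≈[]-weaken m≤n p i<m = p (ℕ.<-≤-trans i<m m≤n)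

  ≈[]⇒≈ : ∀ {f g} → (∀ n → f ≈[ n ] g) → f ≈ g
  ≈[]⇒≈ p n = p (suc n) (ℕ.n<1+n n)

  q : F₂Series
  q = 1 ≡ᵇ_

  q*-suc : ∀ f n → (q * f) (suc n) ≡ f n
  q*-suc f n = *-identityˡ f n

  q^-coefficient : ∀ m → q ^ m ≈ (m ≡ᵇ_)
  q^-coefficient zero    n = ≡.refl
  q^-coefficient (suc m) zero = ≡.refl
  q^-coefficient (suc m) (suc n) = ≡.trans (q*-suc (q ^ m) n) (q^-coefficient m n)

  q^*-shift : ∀ m f n → (q ^ m * f) (m ℕ.+ n) ≡ f n
  q^*-shift zero    f n = *-identityˡ f n
  q^*-shift (suc m) f n = ≡.trans (*-assoc q (q ^ m) f (suc m ℕ.+ n))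
                                  (≡.trans (q*-suc (q ^ m * f) (m ℕ.+ n)) (q^*-shift m f n))

  q^≈[]0 : ∀ {m n} → n ≤ m → q ^ m ≈[ n ] 0#
  q^≈[]0 {m} n≤m {i} i<n = ≡.trans (q^-coefficient m i) (dec-false (m ℕ.≟ i) (ℕ.>⇒≢ (ℕ.<-≤-trans i<n n≤m)))

  q^*≈[]0 : ∀ {m n} → n ≤ m → ∀ f → q ^ m * f ≈[ n ] 0#
  q^*≈[]0 n≤m f = ≈[]-trans (*-cong-≈[] {g = f} (q^≈[]0 n≤m) (λ _ → ≡.refl)) (≈⇒≈[] (zeroˡ f))

  spread-cong-≈[] : ∀ {n f g} e c → f ≈[ n ] g → spread e c f ≈[ n ] spread e c g
  spread-cong-≈[] e zero    p {zero}  i<n       = p i<n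
  spread-cong-≈[] e zero    p {suc i} (s≤s i<n) = spread-cong-≈[] e e (p ∘ s≤s) i<n
  spread-cong-≈[] e (suc c) p {zero}  i<n       = ≡.refl
  spread-cong-≈[] e (suc c) p {suc i} i<n       = spread-cong-≈[] e c p (ℕ.<-trans (ℕ.n<1+n i) i<n)

  dilate-cong : ∀ {f g} e → f ≈ g → dilate e f ≈ dilate e g
  dilate-cong e p = ≈[]⇒≈ λ n → spread-cong-≈[] e 0 (≈⇒≈[] p)

  dilate-1 : ∀ e → dilate e 1# ≈ 1#
  dilate-1 e zero    = ≡.refl
  dilate-1 e (suc n) = spread-0 e e n

  dilate-^ : ∀ e f k → dilate e (f ^ k) ≈ dilate e f ^ k
  dilate-^ e f zero    = dilate-1 e
  dilate-^ e f (suc k) = trans (spread-* e 0 f (f ^ k)) (*-congˡ {dilate e f} (dilate-^ e f k))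

  dilate-q : ∀ e → dilate e q ≈ q ^ suc e
  dilate-q e zero    = ≡.refl
  dilate-q e (suc n) = ≡.trans (lemma e n) (≡.sym (≡.trans (q*-suc (q ^ e) n) (q^-coefficient e n)))
    where
    lemma : ∀ c → spread e c 1# ≈ (c ≡ᵇ_)
    lemma zero    n       = dilate-1 e n
    lemma (suc c) zero    = ≡.refl
    lemma (suc c) (suc n) = lemma c n

  -- Euler products modulo 2

  ⟦fac⟧ : ∀ m .{{_ : NonZero m}} → ⟦ fac m ⟧ ≈ 1# + q ^ m
  ⟦fac⟧ (suc m) zero    = ≡.refl
  ⟦fac⟧ (suc m) (suc n) = ≡.trans (lemma (m ≡ᵇ n)) (≡.sym (q^-coefficient (suc m) (suc n)))
    where
    lemma : ∀ b → parity (if b then ℤ.-1ℤ else ℤ.0ℤ) ≡ b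
    lemma false = ≡.refl
    lemma true  = ≡.refl

  -- The coefficients of 1 / (1 - q^m) have period m, so adding the copy shifted by m cancels all of
  -- them from q^m on; below q^m only the constant 1 is present.
  ⟦invFac⟧*⟦fac⟧ : ∀ m .{{_ : NonZero m}} → ⟦ invFac m ⟧ * ⟦ fac m ⟧ ≈ 1#
  ⟦invFac⟧*⟦fac⟧ m = begin
    g * ⟦ fac m ⟧     ≈⟨ *-congˡ {g} (⟦fac⟧ m) ⟩
    g * (1# + q ^ m)  ≈⟨ trans (distribˡ g 1# (q ^ m)) (+-cong (*-identityʳ g) (*-comm g (q ^ m))) ⟩
    g + q ^ m * g     ≈⟨ lemma ⟩
    1#                ∎
    where
    open import Relation.Binary.Reasoning.Setoid setoid
    g = ⟦ invFac m ⟧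
    parity-if : ∀ b → parity (if b then ℤ.1ℤ else ℤ.0ℤ) ≡ b
    parity-if false = ≡.refl
    parity-if true  = ≡.refl
    g-coefficient : ∀ n → g n ≡ does (m ℕ.∣? n)
    g-coefficient n = parity-if (does (m ℕ.∣? n))
    g-periodic : ∀ n → g (m ℕ.+ n) ≡ g n
    g-periodic n = ≡.trans (g-coefficient (m ℕ.+ n)) (≡.trans
      (does-⇔ (mk⇔ (λ m∣m+n → ℕ.∣m+n∣m⇒∣n m∣m+n ℕ.∣-refl) (ℕ.∣m∣n⇒∣m+n ℕ.∣-refl)) (m ℕ.∣? m ℕ.+ n) (m ℕ.∣? n))
      (≡.sym (g-coefficient n)))
    g-low : g ≈[ m ] 1#
    g-low {zero}  _   = ≡.trans (g-coefficient 0) (dec-true (m ℕ.∣? 0) (m ℕ.∣0))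
    g-low {suc i} i<m = ≡.trans (g-coefficient (suc i)) (dec-false (m ℕ.∣? suc i) (ℕ.>⇒∤ i<m))
    lemma : g + q ^ m * g ≈ 1#
    lemma n with n ℕ.<? m
    ... | yes n<m = ≡.trans (+-cong-≈[] g-low (q^*≈[]0 ℕ.≤-refl g) n<m) (+-identityʳ 1# n)
    ... | no  n≮m with ℕ.m≤n⇒∃[o]m+o≡n (ℕ.≮⇒≥ n≮m)
    ...   | k , ≡.refl = ≡.trans (≡.cong₂ _xor_ (g-periodic k) (q^*-shift m g k))
                                 (≡.trans (xor-same (g k)) (≡.sym (1#-high m k)))
      where
      1#-high : ∀ m k .{{_ : NonZero m}} → 1# (m ℕ.+ k) ≡ false
      1#-high (suc m) k = ≡.refl

  -- `prodInf` takes each coefficient from a different partial product. Factors beyond the i-th do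
  -- not alter the coefficient of q^i, so a single partial product serves all exponents up to n.
  prodInf-≈[] : ∀ F → (∀ k → ⟦ F (suc k) ⟧ ≈[ suc k ] 1#) → ∀ n → ⟦ prodInf F ⟧ ≈[ suc n ] ⟦ prodUpTo F n ⟧
  prodInf-≈[] F F≈1 n {i} (s≤s i≤n) with ℕ.m≤n⇒∃[o]m+o≡n i≤n
  ... | k , ≡.refl = stable k
    where
    stable : ∀ k → ⟦ prodUpTo F i ⟧ i ≡ ⟦ prodUpTo F (i ℕ.+ k) ⟧ i
    stable zero    rewrite ℕ.+-identityʳ i = ≡.refl
    stable (suc k) rewrite ℕ.+-suc i k = ≡.trans (stable k) (≡.sym (≡.trans
      (⟦mul⟧ (prodUpTo F (i ℕ.+ k)) (F (suc (i ℕ.+ k))) i)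
      (≡.trans (*-cong-≈[] {f = ⟦ prodUpTo F (i ℕ.+ k) ⟧} (λ _ → ≡.refl) (F≈1 (i ℕ.+ k)) (s≤s (ℕ.m≤m+n i k)))
               (*-identityʳ ⟦ prodUpTo F (i ℕ.+ k) ⟧ i))))

  module _ (d : ℕ) .{{d≢0 : NonZero d}} where

    private
      d*k≢0 : ∀ k → NonZero (d ℕ.* suc k)
      d*k≢0 k = ℕ.m*n≢0 d (suc k)

    ⟦fac⟧≈[]1 : ∀ k → ⟦ fac (d ℕ.* suc k) ⟧ ≈[ suc k ] 1#
    ⟦fac⟧≈[]1 k = ≈[]-trans (≈⇒≈[] (⟦fac⟧ (d ℕ.* suc k) {{d*k≢0 k}})) (≈[]-trans
      (+-cong-≈[] {f = 1#} (λ _ → ≡.refl) (q^≈[]0 (ℕ.m≤n*m (suc k) d)))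
      (≈⇒≈[] (+-identityʳ 1#)))

    ⟦invFac⟧≈[]1 : ∀ k → ⟦ invFac (d ℕ.* suc k) ⟧ ≈[ suc k ] 1#
    ⟦invFac⟧≈[]1 k = ≈[]-trans
      (≈[]-sym (≈[]-trans (*-cong-≈[] {f = g} (λ _ → ≡.refl) (⟦fac⟧≈[]1 k)) (≈⇒≈[] (*-identityʳ g))))
      (≈⇒≈[] (⟦invFac⟧*⟦fac⟧ (d ℕ.* suc k) {{d*k≢0 k}}))
      where g = ⟦ invFac (d ℕ.* suc k) ⟧

    -- x is fixed only up to `≈` because the dissection produces powers such as (q ^ d) ^ 3 in place
    -- of q ^ (3d).
    ⟦prodUpTo-fac⟧ : ∀ {x} → x ≈ q ^ d → ∀ n → ⟦ prodUpTo (λ k → fac (d ℕ.* k)) n ⟧ ≈ eulerProduct x n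
    ⟦prodUpTo-fac⟧ x≈ zero    = ⟦one⟧
    ⟦prodUpTo-fac⟧ x≈ (suc n) = trans (⟦mul⟧ _ (fac (d ℕ.* suc n)))
      (*-cong (⟦prodUpTo-fac⟧ x≈ n) (trans (⟦fac⟧ (d ℕ.* suc n) {{d*k≢0 n}})
        (+-congˡ {1#} (trans (sym (^-assocʳ q d (suc n))) (^-congˡ (suc n) (sym x≈))))))

    ⟦prodUpTo⟧-inverse : ∀ n → ⟦ prodUpTo (λ k → fac (d ℕ.* k)) n ⟧ * ⟦ prodUpTo (λ k → invFac (d ℕ.* k)) n ⟧ ≈ 1#
    ⟦prodUpTo⟧-inverse zero    = trans (*-cong ⟦one⟧ ⟦one⟧) (*-identityˡ 1#)
    ⟦prodUpTo⟧-inverse (suc n) = begin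
      ⟦ mul p f ⟧ * ⟦ mul p⁻¹ f⁻¹ ⟧             ≈⟨ *-cong (⟦mul⟧ p f) (⟦mul⟧ p⁻¹ f⁻¹) ⟩
      (⟦ p ⟧ * ⟦ f ⟧) * (⟦ p⁻¹ ⟧ * ⟦ f⁻¹ ⟧)
        ≈⟨ trans (interchange ⟦ p ⟧ ⟦ f ⟧ ⟦ p⁻¹ ⟧ ⟦ f⁻¹ ⟧) (*-congˡ {⟦ p ⟧ * ⟦ p⁻¹ ⟧} (*-comm ⟦ f ⟧ ⟦ f⁻¹ ⟧)) ⟩
      (⟦ p ⟧ * ⟦ p⁻¹ ⟧) * (⟦ f⁻¹ ⟧ * ⟦ f ⟧)
        ≈⟨ *-cong (⟦prodUpTo⟧-inverse n) (⟦invFac⟧*⟦fac⟧ (d ℕ.* suc n) {{d*k≢0 n}}) ⟩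
      1# * 1#                                   ≈⟨ *-identityˡ 1# ⟩
      1#                                        ∎
      where
      open import Relation.Binary.Reasoning.Setoid setoid
      open import Algebra.Properties.CommutativeSemigroup (CommutativeRing.*-commutativeSemigroup F₂⟦q⟧)
        using (interchange)
      p   = prodUpTo (λ k → fac (d ℕ.* k)) n
      p⁻¹ = prodUpTo (λ k → invFac (d ℕ.* k)) n
      f   = fac (d ℕ.* suc n)
      f⁻¹ = invFac (d ℕ.* suc n)

    ⟦P⟧-inverse : ⟦ P d ⟧ * ⟦ Pinv d ⟧ ≈ 1#
    ⟦P⟧-inverse n = ≡.trans
      (*-cong-≈[] (prodInf-≈[] _ ⟦fac⟧≈[]1 n) (prodInf-≈[] _ ⟦invFac⟧≈[]1 n) (ℕ.n<1+n n))
      (⟦prodUpTo⟧-inverse n n)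

    ⟦P⟧≈[]eulerProduct : ∀ {x} → x ≈ q ^ d → ∀ n → ⟦ P d ⟧ ≈[ n ] eulerProduct x n
    ⟦P⟧≈[]eulerProduct x≈ n = ≈[]-weaken (ℕ.n≤1+n n)
      (≈[]-trans (prodInf-≈[] _ ⟦fac⟧≈[]1 n) (≈⇒≈[] (⟦prodUpTo-fac⟧ x≈ n)))

    module _ {x : F₂Series} (x≈q^d : x ≈ q ^ d) where

      x^m*≈[]0 : ∀ {m n} → n ≤ m → ∀ f → x ^ m * f ≈[ n ] 0#
      x^m*≈[]0 {m} n≤m f = ≈[]-trans
        (≈⇒≈[] (*-congʳ {f} (trans (^-congˡ m x≈q^d) (^-assocʳ q d m))))
        (q^*≈[]0 (ℕ.≤-trans n≤m (ℕ.m≤n*m m d)) f)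

      pentagonalSum≈[]⟦P⟧ : ∀ n → pentagonalSum x n ≈[ n ] ⟦ P d ⟧
      pentagonalSum≈[]⟦P⟧ n with pentagonalNumberTheorem x n
      ... | r , eq = ≈[]-trans (≈⇒≈[] eq) (≈[]-trans
        (+-cong-≈[] (≈[]-sym (⟦P⟧≈[]eulerProduct x≈q^d n)) (x^m*≈[]0 ℕ.≤-refl r))
        (≈⇒≈[] (+-identityʳ ⟦ P d ⟧)))

      -- Terms of index at least n have exponent at least n. This reconciles the lengths n, 2n + 1
      -- and 3n + 1 that the various finite identities require.
      triangularSum-stable : ∀ k n → triangularSum x (k ℕ.+ n) ≈[ n ] triangularSum x n
      triangularSum-stable zero    n _ = ≡.refl
      triangularSum-stable (suc k) n   = ≈[]-trans
        (+-cong-≈[] (triangularSum-stable k n)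
          (≈[]-trans (≈⇒≈[] (sym (*-identityʳ (x ^ triangular (k ℕ.+ n)))))
                     (x^m*≈[]0 (ℕ.≤-trans (ℕ.m≤n+m n k) (n≤triangular (k ℕ.+ n))) 1#)))
        (≈⇒≈[] (+-identityʳ (triangularSum x n)))
        where
        n≤triangular : ∀ n → n ≤ triangular n
        n≤triangular zero    = z≤n
        n≤triangular (suc n) = ℕ.m≤n+m (suc n) (triangular n)

      ⟦P⟧*triangularSum : ∀ n → ⟦ P d ⟧ * triangularSum x (suc (n ℕ.* 2)) ≈[ n ] ⟦ P d ⟧ ^ 4
      ⟦P⟧*triangularSum n = begin
        ⟦ P d ⟧ * t
          ≈⟨ *-cong-≈[] {g = t} (≈[]-weaken (ℕ.m≤m*n n 2) (⟦P⟧≈[]eulerProduct x≈q^d (n ℕ.* 2))) (λ _ → ≡.refl) ⟩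
        eulerProduct x (n ℕ.* 2) * t   ≈⟨ ≈⇒≈[] (proj₂ (triangularNumberTheorem x n)) ⟨
        eulerProduct x n ^ 4 + x ^ n * r
          ≈⟨ +-cong-≈[] {f = eulerProduct x n ^ 4} (λ _ → ≡.refl) (x^m*≈[]0 ℕ.≤-refl r) ⟩
        eulerProduct x n ^ 4 + 0#      ≈⟨ ≈⇒≈[] (+-identityʳ (eulerProduct x n ^ 4)) ⟩
        eulerProduct x n ^ 4           ≈⟨ ^-cong-≈[] 4 (⟦P⟧≈[]eulerProduct x≈q^d n) ⟨
        ⟦ P d ⟧ ^ 4                    ∎
        where
        open ≈[]-Reasoning n
        t = triangularSum x (suc (n ℕ.* 2))
        r = proj₁ (triangularNumberTheorem x n)

      -- Gauss's theorem gives E d times the sum as E d⁴; one factor E d is cancelled with its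
      -- inverse.
      triangularSum≈[]⟦P⟧³ : ∀ n → triangularSum x n ≈[ n ] ⟦ P d ⟧ ^ 3
      triangularSum≈[]⟦P⟧³ n = begin
        triangularSum x n          ≈⟨ stable ⟨
        t                          ≈⟨ ≈⇒≈[] (cancel t) ⟨
        i * (⟦ P d ⟧ * t)          ≈⟨ *-cong-≈[] {f = i} (λ _ → ≡.refl) (⟦P⟧*triangularSum n) ⟩
        i * (⟦ P d ⟧ * ⟦ P d ⟧ ^ 3) ≈⟨ ≈⇒≈[] (cancel (⟦ P d ⟧ ^ 3)) ⟩
        ⟦ P d ⟧ ^ 3                ∎
        where
        open ≈[]-Reasoning n
        i = ⟦ Pinv d ⟧
        t = triangularSum x (suc (n ℕ.* 2))
        cancel : ∀ f → i * (⟦ P d ⟧ * f) ≈ f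
        cancel f = trans (sym (*-assoc i ⟦ P d ⟧ f))
          (trans (*-congʳ {f} (trans (*-comm i ⟦ P d ⟧) ⟦P⟧-inverse)) (*-identityˡ f))
        stable : t ≈[ n ] triangularSum x n
        stable = ≡.subst (λ k → triangularSum x (suc k) ≈[ n ] triangularSum x n)
          (lemma n) (triangularSum-stable (suc n) n)
          where
          lemma : ∀ n → n ℕ.+ n ≡ n ℕ.* 2
          lemma = solve-∀

  -- Dilation of Euler products

  dilate-eulerProduct : ∀ e x n → dilate e (eulerProduct x n) ≈ eulerProduct (dilate e x) n
  dilate-eulerProduct e x zero    = dilate-1 e
  dilate-eulerProduct e x (suc n) = begin
    dilate e (eulerProduct x n * (1# + x ^ suc n))
      ≈⟨ spread-* e 0 (eulerProduct x n) (1# + x ^ suc n) ⟩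
    dilate e (eulerProduct x n) * dilate e (1# + x ^ suc n)
      ≈⟨ *-cong (dilate-eulerProduct e x n) (spread-linear e 0 true 1# (x ^ suc n)) ⟩
    eulerProduct (dilate e x) n * (dilate e 1# + dilate e (x ^ suc n))
      ≈⟨ *-congˡ {eulerProduct (dilate e x) n} (+-cong (dilate-1 e) (dilate-^ e x (suc n))) ⟩
    eulerProduct (dilate e x) (suc n) ∎
    where open import Relation.Binary.Reasoning.Setoid setoid

  dilate-⟦P⟧ : ∀ e d .{{_ : NonZero d}} → dilate e ⟦ P d ⟧ ≈ ⟦ P (suc e ℕ.* d) ⟧
  dilate-⟦P⟧ e d = ≈[]⇒≈ λ n → let open ≈[]-Reasoning n in begin
    dilate e ⟦ P d ⟧                     ≈⟨ spread-cong-≈[] e 0 (⟦P⟧≈[]eulerProduct d refl n) ⟩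
    dilate e (eulerProduct (q ^ d) n)    ≈⟨ ≈⇒≈[] (dilate-eulerProduct e (q ^ d) n) ⟩
    eulerProduct (dilate e (q ^ d)) n    ≈⟨ ⟦P⟧≈[]eulerProduct (suc e ℕ.* d) {{ℕ.m*n≢0 (suc e) d}} dilate-q^d n ⟨
    ⟦ P (suc e ℕ.* d) ⟧                  ∎
    where
    dilate-q^d : dilate e (q ^ d) ≈ q ^ (suc e ℕ.* d)
    dilate-q^d = trans (dilate-^ e q d) (trans (^-congˡ d (dilate-q e)) (^-assocʳ q (suc e) d))

  -- Dilation is multiplicative, so it sends the inverse of E d to an inverse of the dilated
  -- product, and inverses are unique.
  dilate-⟦Pinv⟧ : ∀ e d .{{_ : NonZero d}} → dilate e ⟦ Pinv d ⟧ ≈ ⟦ Pinv (suc e ℕ.* d) ⟧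
  dilate-⟦Pinv⟧ e d = begin
    i                                ≈⟨ *-identityʳ i ⟨
    i * 1#                           ≈⟨ *-congˡ {i} (⟦P⟧-inverse (suc e ℕ.* d) {{ℕ.m*n≢0 (suc e) d}}) ⟨
    i * (p * ⟦ Pinv (suc e ℕ.* d) ⟧) ≈⟨ *-assoc i p ⟦ Pinv (suc e ℕ.* d) ⟧ ⟨
    (i * p) * ⟦ Pinv (suc e ℕ.* d) ⟧ ≈⟨ *-congʳ {⟦ Pinv (suc e ℕ.* d) ⟧} ip≈1 ⟩
    1# * ⟦ Pinv (suc e ℕ.* d) ⟧      ≈⟨ *-identityˡ ⟦ Pinv (suc e ℕ.* d) ⟧ ⟩
    ⟦ Pinv (suc e ℕ.* d) ⟧           ∎
    where
    open import Relation.Binary.Reasoning.Setoid setoid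
    i = dilate e ⟦ Pinv d ⟧
    p = ⟦ P (suc e ℕ.* d) ⟧
    ip≈1 : i * p ≈ 1#
    ip≈1 = begin
      i * p                             ≈⟨ *-comm i p ⟩
      p * i                             ≈⟨ *-congʳ {i} (dilate-⟦P⟧ e d) ⟨
      dilate e ⟦ P d ⟧ * i              ≈⟨ spread-* e 0 ⟦ P d ⟧ ⟦ Pinv d ⟧ ⟨
      dilate e (⟦ P d ⟧ * ⟦ Pinv d ⟧)   ≈⟨ dilate-cong e (⟦P⟧-inverse d) ⟩
      dilate e 1#                       ≈⟨ dilate-1 e ⟩
      1#                                ∎

  -- The cubic dissection and the level 6 relation

  ⟦P⟧³ : ∀ d .{{_ : NonZero d}} → ⟦ P d ⟧ ^ 3 ≈ ⟦ P (3 ℕ.* d) ⟧ + q ^ d * ⟦ P (3 ℕ.* (3 ℕ.* d)) ⟧ ^ 3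
  ⟦P⟧³ d = ≈[]⇒≈ λ n → let open ≈[]-Reasoning n in begin
    ⟦ P d ⟧ ^ 3                        ≈⟨ triangularSum≈[]⟦P⟧³ d refl n ⟨
    -- The sum is lengthened to 3n + 1 terms, so that index 0 is followed by n full blocks of three.
    triangularSum x n                  ≈⟨ triangularSum-stable d refl (suc (n ℕ.* 2)) n ⟨
    triangularSum x (suc (n ℕ.* 2) ℕ.+ n) ≡⟨ ≡.cong (λ k → triangularSum x (suc k)) (n*2+n≡n*3 n) ⟩
    triangularSum x (suc (n ℕ.* 3))    ≈⟨ ≈⇒≈[] (triangularSum-dissection x n) ⟩
    pentagonalSum (x ^ 3) n + x * triangularSum (x ^ 9) n
      ≈⟨ +-cong-≈[] (pentagonalSum≈[]⟦P⟧ (3 ℕ.* d) {{3d≢0}} (power 3 (ℕ.*-comm d 3)) n)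
           (*-cong-≈[] {f = x} (λ _ → ≡.refl)
             (triangularSum≈[]⟦P⟧³ (3 ℕ.* (3 ℕ.* d)) {{9d≢0}} (power 9 (d*9≡3*3*d d)) n)) ⟩
    ⟦ P (3 ℕ.* d) ⟧ + x * ⟦ P (3 ℕ.* (3 ℕ.* d)) ⟧ ^ 3 ∎
    where
    x = q ^ d
    3d≢0 : NonZero (3 ℕ.* d)
    3d≢0 = ℕ.m*n≢0 3 d
    9d≢0 : NonZero (3 ℕ.* (3 ℕ.* d))
    9d≢0 = ℕ.m*n≢0 3 (3 ℕ.* d) {{_}} {{3d≢0}}
    power : ∀ k {m} → d ℕ.* k ≡ m → x ^ k ≈ q ^ m
    power k eq = trans (^-assocʳ q d k) (^-congʳ q eq)
    n*2+n≡n*3 : ∀ n → n ℕ.* 2 ℕ.+ n ≡ n ℕ.* 3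
    n*2+n≡n*3 = solve-∀
    d*9≡3*3*d : ∀ d → d ℕ.* 9 ≡ 3 ℕ.* (3 ℕ.* d)
    d*9≡3*3*d = solve-∀

  -- This is D(q^d), kept for all d at once because the descent leads from d to 3d.
  level6-defect : ℕ → F₂Series
  level6-defect d = ⟦ P d ⟧ ^ 3 * ⟦ P (3 ℕ.* d) ⟧ ^ 3 + (⟦ P d ⟧ ^ 12 + q ^ d * ⟦ P (3 ℕ.* d) ⟧ ^ 12)

  -- Infinite descent: every instance is q^d times another one.
  level6-defect≈[]0 : ∀ n d .{{_ : NonZero d}} → level6-defect d ≈[ n ] 0#
  level6-defect≈[]0 (suc n) d@(suc d-1) = ≈[]-trans (≈⇒≈[] descent) divisible
    where
    b = ⟦ P (3 ℕ.* d) ⟧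
    c = ⟦ P (3 ℕ.* (3 ℕ.* d)) ⟧
    f = level6-defect (3 ℕ.* d)
    descent : level6-defect d ≈ q ^ d * f
    descent = trans (level6-descent (⟦P⟧³ d))
      (*-congˡ {q ^ d} (+-congˡ {b ^ 3 * c ^ 3} (+-congˡ {b ^ 12} (*-congʳ {c ^ 12}
        (trans (^-assocʳ q d 3) (^-congʳ q (ℕ.*-comm d 3)))))))
    divisible : q ^ d * f ≈[ suc n ] 0#
    divisible {zero}  _         = ≡.refl
    divisible {suc i} (s≤s i<n) = ≡.trans (*-assoc q (q ^ d-1) f (suc i)) (≡.trans (q*-suc (q ^ d-1 * f) i)
      (≡.trans (*-cong-≈[] {f = q ^ d-1} (λ _ → ≡.refl) (level6-defect≈[]0 n (3 ℕ.* d)) i<n) (zeroʳ (q ^ d-1) i)))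

  ⟦P⟧³⟦P⟧³ : ∀ d .{{_ : NonZero d}} →
             ⟦ P d ⟧ ^ 3 * ⟦ P (3 ℕ.* d) ⟧ ^ 3 ≈ ⟦ P d ⟧ ^ 12 + q ^ d * ⟦ P (3 ℕ.* d) ⟧ ^ 12
  ⟦P⟧³⟦P⟧³ d = x+y≈0⇒x≈y _ _ (≈[]⇒≈ λ n → level6-defect≈[]0 n d)

  -- The Hauptmoduln modulo 2

  dilate-even : ∀ f n → dilate 1 f (n ℕ.* 2) ≡ f n
  dilate-even f zero    = ≡.refl
  dilate-even f (suc n) = dilate-even (f ∘ suc) n

  dilate-odd : ∀ f n → dilate 1 f (suc (n ℕ.* 2)) ≡ false
  dilate-odd f zero    = ≡.refl
  dilate-odd f (suc n) = dilate-odd (f ∘ suc) n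

  dilate-3n : ∀ f n → dilate 2 f (n ℕ.* 3) ≡ f n
  dilate-3n f zero    = ≡.refl
  dilate-3n f (suc n) = dilate-3n (f ∘ suc) n

  dilate-3n+1 : ∀ f n → dilate 2 f (1 ℕ.+ n ℕ.* 3) ≡ false
  dilate-3n+1 f zero    = ≡.refl
  dilate-3n+1 f (suc n) = dilate-3n+1 (f ∘ suc) n

  dilate-3n+2 : ∀ f n → dilate 2 f (2 ℕ.+ n ℕ.* 3) ≡ false
  dilate-3n+2 f zero    = ≡.refl
  dilate-3n+2 f (suc n) = dilate-3n+2 (f ∘ suc) n

  u v : F₂Series
  u = ⟦ P 1 ⟧ ^ 3 * ⟦ Pinv 3 ⟧ ^ 3
  v = ⟦ P 3 ⟧ ^ 3 * ⟦ Pinv 1 ⟧ ^ 3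

  v[q³] : ⟦ P 9 ⟧ ^ 3 * ⟦ Pinv 3 ⟧ ^ 3 ≈ dilate 2 v
  v[q³] = sym (trans (spread-* 2 0 (⟦ P 3 ⟧ ^ 3) (⟦ Pinv 1 ⟧ ^ 3)) (*-cong
    (trans (dilate-^ 2 ⟦ P 3 ⟧ 3) (^-congˡ 3 (dilate-⟦P⟧ 2 3)))
    (trans (dilate-^ 2 ⟦ Pinv 1 ⟧ 3) (^-congˡ 3 (dilate-⟦Pinv⟧ 2 1)))))

  u-dissection : u ≈ dilate 1 ⟦ Pinv 3 ⟧ + q ^ 1 * dilate 2 v
  u-dissection = trans (a³/b³ (⟦P⟧³ 1) (⟦P⟧-inverse 1) (⟦P⟧-inverse 3))
    (+-cong (frobenius ⟦ Pinv 3 ⟧) (*-congˡ {q ^ 1} v[q³]))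

  ⟦P⟧² : ∀ d .{{_ : NonZero d}} → ⟦ P (2 ℕ.* d) ⟧ ≈ ⟦ P d ⟧ * ⟦ P d ⟧
  ⟦P⟧² d = trans (sym (dilate-⟦P⟧ 1 d)) (sym (frobenius ⟦ P d ⟧))

  ⟦Pinv⟧² : ∀ d .{{_ : NonZero d}} → ⟦ Pinv (2 ℕ.* d) ⟧ ≈ ⟦ Pinv d ⟧ * ⟦ Pinv d ⟧
  ⟦Pinv⟧² d = trans (sym (dilate-⟦Pinv⟧ 1 d)) (sym (frobenius ⟦ Pinv d ⟧))

  ⟦B⟧ : ⟦ B ⟧ ≈ ((⟦ P 1 ⟧ * ⟦ P 1 ⟧) * ⟦ P 3 ⟧ ^ 3) * (⟦ Pinv 1 ⟧ * (⟦ Pinv 3 ⟧ * ⟦ Pinv 3 ⟧) ^ 3)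
  ⟦B⟧ = trans (⟦mul⟧ (mul (P 2) (pow (P 3) 3)) (mul (Pinv 1) (pow (Pinv 6) 3))) (*-cong
    (trans (⟦mul⟧ (P 2) (pow (P 3) 3)) (*-cong (⟦P⟧² 1) (⟦pow⟧ (P 3) 3)))
    (trans (⟦mul⟧ (Pinv 1) (pow (Pinv 6) 3))
      (*-congˡ {⟦ Pinv 1 ⟧} (trans (⟦pow⟧ (Pinv 6) 3) (^-congˡ 3 (⟦Pinv⟧² 3))))))

  ⟦A⟧ : ⟦ A ⟧ ≈ (⟦ P 1 ⟧ * ⟦ P 3 ⟧) * ((⟦ Pinv 1 ⟧ * ⟦ Pinv 1 ⟧) * (⟦ Pinv 3 ⟧ * ⟦ Pinv 3 ⟧))
  ⟦A⟧ = trans (⟦mul⟧ (mul (P 1) (P 3)) (mul (Pinv 2) (Pinv 6))) (*-cong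
    (⟦mul⟧ (P 1) (P 3))
    (trans (⟦mul⟧ (Pinv 2) (Pinv 6)) (*-cong (⟦Pinv⟧² 1) (⟦Pinv⟧² 3))))

  square² : ∀ f → (f * f) * (f * f) ≈ dilate 1 (dilate 1 f)
  square² f = trans (frobenius (f * f)) (dilate-cong 1 (frobenius f))

  ⟦B³⟧ : ⟦ B³ ⟧ ≈ dilate 1 (dilate 1 u) + q ^ 1
  ⟦B³⟧ = trans (⟦pow⟧ B 3) (trans (^-congˡ 3 ⟦B⟧) (trans
    (j₆-quotient (⟦P⟧³ 1) (⟦P⟧-inverse 1) (⟦P⟧-inverse 3) (⟦P⟧³⟦P⟧³ 1))
    (+-congʳ {q ^ 1} (square² u))))

  ⟦A⁶⟧ : ⟦ A⁶ ⟧ ≈ dilate 1 (dilate 1 u + q ^ 1 * dilate 1 v)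
  ⟦A⁶⟧ = trans (⟦pow⟧ A 6) (trans (^-congˡ 6 ⟦A⟧) (trans
    (j₆*-quotient (⟦P⟧³ 1) (⟦P⟧-inverse 1) (⟦P⟧-inverse 3) (⟦P⟧³⟦P⟧³ 1))
    (trans (frobenius (u * u + q ^ 1 * (v * v)))
      (dilate-cong 1 (+-cong (frobenius u) (*-congˡ {q ^ 1} (frobenius v)))))))

  -- The index moves by one because of the leading 1/q. The summand `q ^ 1` of `⟦B³⟧` affects only
  -- the constant term of j₆, which n ≥ 1 leaves out.
  ⟦J6⟧ : ∀ n → 1 ≤ n → ⟦ J6 ⟧ n ≡ dilate 1 (dilate 1 u) (suc n)
  ⟦J6⟧ (suc n) _ = ≡.trans (⟦B³⟧ (suc (suc n)))
    (≡.trans (≡.cong (dilate 1 (dilate 1 u) (suc (suc n)) xor_) (q^-coefficient 1 (suc (suc n)))) (xor-identityʳ _))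

  ⟦J6*⟧ : ∀ n → 1 ≤ n → ⟦ J6* ⟧ n ≡ dilate 1 (dilate 1 u + q ^ 1 * dilate 1 v) (suc n)
  ⟦J6*⟧ (suc n) _ = ≡.trans (parity-+ (A⁶ (suc (suc n))) (+ 64 ℤ.* Ainv⁶ n)) (≡.trans
    (≡.cong (⟦ A⁶ ⟧ (suc (suc n)) xor_) (parity-* (+ 64) (Ainv⁶ n)))
    (≡.trans (xor-identityʳ _) (⟦A⁶⟧ (suc (suc n)))))

  -- Coefficients in residue classes

  -- The summand E 3⁻² of u is a square, so it has no odd exponents.
  u-odd : ∀ n → u (suc (n ℕ.* 2)) ≡ dilate 2 v (n ℕ.* 2)
  u-odd n = ≡.trans (u-dissection (suc (n ℕ.* 2)))
    (≡.cong₂ _xor_ (dilate-odd ⟦ Pinv 3 ⟧ n) (q^*-shift 1 (dilate 2 v) (n ℕ.* 2)))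

  ⟦J6⟧-even : ∀ n → 1 ≤ n → ⟦ J6 ⟧ (n ℕ.* 2) ≡ false
  ⟦J6⟧-even n 1≤n = ≡.trans (⟦J6⟧ (n ℕ.* 2) (ℕ.*-mono-≤ 1≤n (s≤s {n = 1} z≤n))) (dilate-odd (dilate 1 u) n)

  ⟦J6*⟧-even : ∀ n → 1 ≤ n → ⟦ J6* ⟧ (n ℕ.* 2) ≡ false
  ⟦J6*⟧-even n 1≤n = ≡.trans (⟦J6*⟧ (n ℕ.* 2) (ℕ.*-mono-≤ 1≤n (s≤s {n = 1} z≤n)))
    (dilate-odd (dilate 1 u + q ^ 1 * dilate 1 v) n)

  ⟦J6⟧-4n+1 : ∀ n → ⟦ J6 ⟧ (1 ℕ.+ n ℕ.* 2 ℕ.* 2) ≡ false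
  ⟦J6⟧-4n+1 n = ≡.trans (⟦J6⟧ (1 ℕ.+ n ℕ.* 2 ℕ.* 2) (s≤s z≤n))
    (≡.trans (dilate-even (dilate 1 u) (suc (n ℕ.* 2))) (dilate-odd u n))

  ⟦J6⟧-4n+3 : ∀ n → ⟦ J6 ⟧ (3 ℕ.+ n ℕ.* 2 ℕ.* 2) ≡ u (suc n)
  ⟦J6⟧-4n+3 n = ≡.trans (⟦J6⟧ (3 ℕ.+ n ℕ.* 2 ℕ.* 2) (s≤s z≤n))
    (≡.trans (dilate-even (dilate 1 u) (suc n ℕ.* 2)) (dilate-even u (suc n)))

  -- u⁴ has exponents 0 mod 4 and q² v⁴ has exponents 2 mod 4, so the exponent 4n + 4 sees u alone;
  -- `⟦J6*⟧-4n+1` is the complementary case.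
  ⟦J6*⟧-4n+3 : ∀ n → ⟦ J6* ⟧ (3 ℕ.+ n ℕ.* 2 ℕ.* 2) ≡ u (suc n)
  ⟦J6*⟧-4n+3 n = ≡.trans (⟦J6*⟧ (3 ℕ.+ n ℕ.* 2 ℕ.* 2) (s≤s z≤n)) (≡.trans
    (dilate-even (dilate 1 u + q ^ 1 * dilate 1 v) (suc n ℕ.* 2))
    (≡.trans (≡.cong₂ _xor_ (dilate-even u (suc n))
                            (≡.trans (q^*-shift 1 (dilate 1 v) (suc (n ℕ.* 2))) (dilate-odd v n)))
             (xor-identityʳ (u (suc n)))))

  ⟦J6*⟧-4n+1 : ∀ n → ⟦ J6* ⟧ (1 ℕ.+ n ℕ.* 2 ℕ.* 2) ≡ dilate 1 v (n ℕ.* 2)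
  ⟦J6*⟧-4n+1 n = ≡.trans (⟦J6*⟧ (1 ℕ.+ n ℕ.* 2 ℕ.* 2) (s≤s z≤n)) (≡.trans
    (dilate-even (dilate 1 u + q ^ 1 * dilate 1 v) (suc (n ℕ.* 2)))
    (≡.cong₂ _xor_ (dilate-odd u n) (q^*-shift 1 (dilate 1 v) (n ℕ.* 2))))

  u-6n+3 : ∀ n → u (3 ℕ.+ n ℕ.* 3 ℕ.* 2) ≡ false
  u-6n+3 n = ≡.trans (u-odd (1 ℕ.+ n ℕ.* 3)) (≡.trans (≡.cong (dilate 2 v) (lemma n)) (dilate-3n+2 v (n ℕ.* 2)))
    where
    lemma : ∀ n → (1 ℕ.+ n ℕ.* 3) ℕ.* 2 ≡ 2 ℕ.+ n ℕ.* 2 ℕ.* 3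
    lemma = solve-∀

  u-6n+5 : ∀ n → u (5 ℕ.+ n ℕ.* 3 ℕ.* 2) ≡ false
  u-6n+5 n = ≡.trans (u-odd (2 ℕ.+ n ℕ.* 3)) (≡.trans (≡.cong (dilate 2 v) (lemma n)) (dilate-3n+1 v (1 ℕ.+ n ℕ.* 2)))
    where
    lemma : ∀ n → (2 ℕ.+ n ℕ.* 3) ℕ.* 2 ≡ 1 ℕ.+ (1 ℕ.+ n ℕ.* 2) ℕ.* 3
    lemma = solve-∀

  -- Both sides are the coefficient of q^{2n} in v: on the right, u at 6n + 1 is v(q³) at 6n.
  ⟦J6*⟧-8n+1 : ∀ n → ⟦ J6* ⟧ (1 ℕ.+ n ℕ.* 2 ℕ.* 2 ℕ.* 2) ≡ ⟦ J6 ⟧ (3 ℕ.+ n ℕ.* 3 ℕ.* 2 ℕ.* 2 ℕ.* 2)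
  ⟦J6*⟧-8n+1 n = begin
    ⟦ J6* ⟧ (1 ℕ.+ n ℕ.* 2 ℕ.* 2 ℕ.* 2)        ≡⟨ ⟦J6*⟧-4n+1 (n ℕ.* 2) ⟩
    dilate 1 v (n ℕ.* 2 ℕ.* 2)                 ≡⟨ dilate-even v (n ℕ.* 2) ⟩
    v (n ℕ.* 2)                                ≡⟨ dilate-3n v (n ℕ.* 2) ⟨
    dilate 2 v (n ℕ.* 2 ℕ.* 3)                 ≡⟨ ≡.cong (dilate 2 v) (lemma n) ⟩
    dilate 2 v (n ℕ.* 3 ℕ.* 2)                 ≡⟨ u-odd (n ℕ.* 3) ⟨
    u (1 ℕ.+ n ℕ.* 3 ℕ.* 2)                    ≡⟨ ⟦J6⟧-4n+3 (n ℕ.* 3 ℕ.* 2) ⟨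
    ⟦ J6 ⟧ (3 ℕ.+ n ℕ.* 3 ℕ.* 2 ℕ.* 2 ℕ.* 2)   ∎
    where
    open ≡.≡-Reasoning
    lemma : ∀ n → n ℕ.* 2 ℕ.* 3 ≡ n ℕ.* 3 ℕ.* 2
    lemma = solve-∀

open import Data.Nat using (ℕ; _≤_; _*_; _+_; _∸_)
open import Data.Integer using (_-_; +_)
open ModTwo

theorem1p5 : (n : ℕ) → 1 ≤ n →
    ((+ 2 ∣ J6* (2 * n) × + 2 ∣ J6 (2 * n))
    × + 2 ∣ J6 (4 * n + 1)
    × (+ 2 ∣ J6* (24 * n + 11) × + 2 ∣ J6* (24 * n + 19)
    × + 2 ∣ J6 (24 * n + 11) × + 2 ∣ J6 (24 * n + 19))
    × + 2 ∣ (J6* (4 * n ∸ 1) - J6 (4 * n ∸ 1))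
    × + 2 ∣ (J6* (8 * n + 1) - J6 (24 * n + 3)))
theorem1p5 n@(suc m) 1≤n =
  (even J6* (2 * n) (e₂ n) (⟦J6*⟧-even n 1≤n) , even J6 (2 * n) (e₂ n) (⟦J6⟧-even n 1≤n))
  , even J6 (4 * n + 1) (e₄ n) (⟦J6⟧-4n+1 n)
  -- 24n + 11 = 4(6n + 2) + 3 leads to u at 6n + 3, and 24n + 19 = 4(6n + 4) + 3 to u at 6n + 5.
  , ( even J6* (24 * n + 11) (e₁₁ n) (≡.trans (⟦J6*⟧-4n+3 (2 + n * 3 * 2)) (u-6n+3 n))
    , even J6* (24 * n + 19) (e₁₉ n) (≡.trans (⟦J6*⟧-4n+3 (4 + n * 3 * 2)) (u-6n+5 n))
    , even J6 (24 * n + 11) (e₁₁ n) (≡.trans (⟦J6⟧-4n+3 (2 + n * 3 * 2)) (u-6n+3 n))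
    , even J6 (24 * n + 19) (e₁₉ n) (≡.trans (⟦J6⟧-4n+3 (4 + n * 3 * 2)) (u-6n+5 n)))
  -- With m = n - 1, 4n - 1 is 4m + 3, and both parities are the coefficient of q^n in u.
  , parity-≡⇒2∣ (J6* (4 * n ∸ 1)) (J6 (4 * n ∸ 1)) (≡.subst (λ k → ⟦ J6* ⟧ k ≡ ⟦ J6 ⟧ k) (e₃ m)
      (≡.trans (⟦J6*⟧-4n+3 m) (≡.sym (⟦J6⟧-4n+3 m))))
  , parity-≡⇒2∣ (J6* (8 * n + 1)) (J6 (24 * n + 3))
      (≡.trans (≡.cong ⟦ J6* ⟧ (e₈ n)) (≡.trans (⟦J6*⟧-8n+1 n) (≡.cong ⟦ J6 ⟧ (≡.sym (e₂₄ n)))))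
  where
  even : ∀ f i {j} → i ≡ j → ⟦ f ⟧ j ≡ false → + 2 ∣ f i
  even f i i≡j eq = parity⇒2∣ (f i) (≡.trans (≡.cong ⟦ f ⟧ i≡j) eq)
  e₂ : ∀ n → 2 * n ≡ n * 2
  e₂ = solve-∀
  e₄ : ∀ n → 4 * n + 1 ≡ 1 + n * 2 * 2
  e₄ = solve-∀
  e₁₁ : ∀ n → 24 * n + 11 ≡ 3 + (2 + n * 3 * 2) * 2 * 2
  e₁₁ = solve-∀
  e₁₉ : ∀ n → 24 * n + 19 ≡ 3 + (4 + n * 3 * 2) * 2 * 2
  e₁₉ = solve-∀
  e₃ : ∀ m → 3 + m * 2 * 2 ≡ 4 * suc m ∸ 1
  e₃ m = ≡.cong (_∸ 1) (lemma m)
    where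
    lemma : ∀ m → 4 + m * 2 * 2 ≡ 4 * suc m
    lemma = solve-∀
  e₈ : ∀ n → 8 * n + 1 ≡ 1 + n * 2 * 2 * 2
  e₈ = solve-∀
  e₂₄ : ∀ n → 24 * n + 3 ≡ 3 + n * 3 * 2 * 2 * 2
  e₂₄ = solve-∀
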